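{- Let $G$ be a finite simple connected graph with $m$ edges and spectral radius $\rho(G) > \sqrt{m}$ (that is, $G$ is a Nosal graph). Then $$\mathrm{bk}(G) > \frac{1}{9}\sqrt{m}.$$
   Context: All graphs are finite, simple and connected, and have no isolated vertices. For a graph $G$, $\rho(G)$ denotes its spectral radius, i.e. the largest eigenvalue of its adjacency matrix. A graph $G$ with $m$ edges is called Nosal if $\rho(G)>\sqrt{m}$. For an integer $k\ge 1$, the book of size $k$, denoted $B_k$, is the graph formed by $k$ triangles sharing a common edge. The booksize $\mathrm{bk}(G)$ is the maximum integer $k$ for which $B_k$ is a (not necessarily induced) subgraph of $G$ (with $\mathrm{bk}(G)=0$ if $G$ is triangle-free); equivalently, it is the maximum, over edges of $G$, of the number of triangles containing that edge. -}

module Defs where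

open import Data.Bool using (if_then_else_)
open import Data.Fin as F using (Fin; toℕ)
import Data.Fin.Properties as F
open import Data.Integer as ℤ using (+_; +[1+_])
import Data.Integer.Properties as ℤ
open import Data.List using (List; allFin; cartesianProduct; filter; length)
open import Data.Nat as ℕ using (ℕ; zero; suc)
import Data.Nat.Properties as ℕ
import Data.Nat.Solver as ℕ
open import Data.Product using (Σ; ∃; _×_; _,_; ∃-syntax)
import Data.Rational as ℚ
open ℚ using (ℚ; mkℚ; 0ℚ; 1ℚ; ½; ∣_∣; toℚᵘ)
import Data.Rational.Properties as ℚ
open import Data.Rational.Solver using (module +-*-Solver)
import Data.Rational.Unnormalised as ℚᵘ
import Data.Rational.Unnormalised.Properties as ℚᵘ
open import Data.Sum as Sum using (_⊎_; inj₁; inj₂)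
open import Data.Vec.Functional using (Vector; foldr)
open import Function using (_∘_)
open import Function.Definitions using (Injective)
open import Relation.Binary.Construct.Closure.ReflexiveTransitive using (Star)
open import Relation.Binary.Definitions using (Decidable; Symmetric; Irreflexive)
open import Relation.Binary.PropositionalEquality
  using (_≡_; _≢_; refl; sym; trans; cong; subst; subst₂)
open import Relation.Nullary using (¬_; yes; no; does; _×-dec_; _⊎-dec_; ¬?)

------------------------------------------------------------------------
-- Real numbers: Cauchy sequences of rationals, with setoid equality _≈_.

IsCauchy : (ℕ → ℚ) → Set
IsCauchy s = ∀ ε → 0ℚ ℚ.< ε →
  ∃[ N ] ∀ m n → N ℕ.≤ m → N ℕ.≤ n → ∣ s m ℚ.- s n ∣ ℚ.< ε

record ℝ : Set where
  constructor mkℝ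
  field
    seq    : ℕ → ℚ
    cauchy : IsCauchy seq

open ℝ public

infix 4 _≈_ _<_ _≤_

_≈_ : ℝ → ℝ → Set
x ≈ y = ∀ ε → 0ℚ ℚ.< ε →
  ∃[ N ] ∀ n → N ℕ.≤ n → ∣ seq x n ℚ.- seq y n ∣ ℚ.< ε

_<_ : ℝ → ℝ → Set
x < y = ∃[ ε ] 0ℚ ℚ.< ε × ∃[ N ] ∀ n → N ℕ.≤ n → seq x n ℚ.+ ε ℚ.< seq y n

_≤_ : ℝ → ℝ → Set
x ≤ y = ¬ (y < x)

fromℚ : ℚ → ℝ
fromℚ q = mkℝ (λ _ → q) λ ε 0<ε → 0 , λ _ _ _ _ →
  subst (λ r → ∣ r ∣ ℚ.< ε) (sym (ℚ.+-inverseʳ q)) 0<ε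

fromℕ : ℕ → ℝ
fromℕ n = fromℚ (+ n ℚ./ 1)

0ℝ 1ℝ : ℝ
0ℝ = fromℚ 0ℚ
1ℝ = fromℚ 1ℚ

private
  half-pos : ∀ {ε} → 0ℚ ℚ.< ε → 0ℚ ℚ.< ½ ℚ.* ε
  half-pos {ε} 0<ε = subst (ℚ._< ½ ℚ.* ε) (ℚ.*-zeroʳ ½) (ℚ.*-monoʳ-<-pos ½ 0<ε)

  halves : ∀ ε → ½ ℚ.* ε ℚ.+ ½ ℚ.* ε ≡ ε
  halves ε = trans (sym (ℚ.*-distribʳ-+ ε ½ ½)) (ℚ.*-identityˡ ε)

  ⊔-≤ˡ : ∀ M N {k} → M ℕ.⊔ N ℕ.≤ k → M ℕ.≤ k
  ⊔-≤ˡ M N = ℕ.≤-trans (ℕ.m≤m⊔n M N)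

  ⊔-≤ʳ : ∀ M N {k} → M ℕ.⊔ N ℕ.≤ k → N ℕ.≤ k
  ⊔-≤ʳ M N = ℕ.≤-trans (ℕ.m≤n⊔m M N)

infixl 6 _+_
infixl 7 _*_

_+_ : ℝ → ℝ → ℝ
x + y = mkℝ (λ n → seq x n ℚ.+ seq y n) isCauchy
  where
  regroup : ∀ a b c d → (a ℚ.+ b) ℚ.- (c ℚ.+ d) ≡ (a ℚ.- c) ℚ.+ (b ℚ.- d)
  regroup = solve 4 (λ a b c d → (a :+ b) :- (c :+ d) := (a :- c) :+ (b :- d)) refl
    where open +-*-Solver

  isCauchy : IsCauchy (λ n → seq x n ℚ.+ seq y n)
  isCauchy ε 0<ε with cauchy x _ (half-pos 0<ε) | cauchy y _ (half-pos 0<ε)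
  ... | M , hM | N , hN = M ℕ.⊔ N , λ m n M⊔N≤m M⊔N≤n → begin-strict
    ∣ (seq x m ℚ.+ seq y m) ℚ.- (seq x n ℚ.+ seq y n) ∣
      ≡⟨ cong ∣_∣ (regroup (seq x m) (seq y m) (seq x n) (seq y n)) ⟩
    ∣ (seq x m ℚ.- seq x n) ℚ.+ (seq y m ℚ.- seq y n) ∣
      ≤⟨ ℚ.∣p+q∣≤∣p∣+∣q∣ (seq x m ℚ.- seq x n) (seq y m ℚ.- seq y n) ⟩
    ∣ seq x m ℚ.- seq x n ∣ ℚ.+ ∣ seq y m ℚ.- seq y n ∣
      <⟨ ℚ.+-mono-< (hM m n (⊔-≤ˡ M N M⊔N≤m) (⊔-≤ˡ M N M⊔N≤n))
                    (hN m n (⊔-≤ʳ M N M⊔N≤m) (⊔-≤ʳ M N M⊔N≤n)) ⟩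
    ½ ℚ.* ε ℚ.+ ½ ℚ.* ε
      ≡⟨ halves ε ⟩
    ε ∎
    where open ℚ.≤-Reasoning

eventually-bounded : ∀ x →
  ∃[ B ] ℚ.Positive B × ∃[ N ] ∀ n → N ℕ.≤ n → ∣ seq x n ∣ ℚ.≤ B
eventually-bounded x with cauchy x 1ℚ (ℚ.positive⁻¹ 1ℚ)
... | N , h = B , ℚ.pos+nonNeg⇒pos 1ℚ ∣ seq x N ∣ {{ℚ.∣-∣-nonNeg (seq x N)}}
            , N , bound
  where
  B = 1ℚ ℚ.+ ∣ seq x N ∣

  split : ∀ a b → a ≡ (a ℚ.- b) ℚ.+ b
  split = solve 2 (λ a b → a := (a :- b) :+ b) refl
    where open +-*-Solver

  bound : ∀ n → N ℕ.≤ n → ∣ seq x n ∣ ℚ.≤ B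
  bound n N≤n = begin
    ∣ seq x n ∣
      ≡⟨ cong ∣_∣ (split (seq x n) (seq x N)) ⟩
    ∣ (seq x n ℚ.- seq x N) ℚ.+ seq x N ∣
      ≤⟨ ℚ.∣p+q∣≤∣p∣+∣q∣ (seq x n ℚ.- seq x N) (seq x N) ⟩
    ∣ seq x n ℚ.- seq x N ∣ ℚ.+ ∣ seq x N ∣
      ≤⟨ ℚ.+-monoˡ-≤ ∣ seq x N ∣ (ℚ.<⇒≤ (h n N N≤n ℕ.≤-refl)) ⟩
    B ∎
    where open ℚ.≤-Reasoning

private
  -- If |u| ≤ B and |d| < δ/B then |u d| < δ.
  scaled : ∀ δ B .{{_ : ℚ.Positive B}} → 0ℚ ℚ.< δ →
           ∃[ η ] 0ℚ ℚ.< η × ∀ u d → ∣ u ∣ ℚ.≤ B → ∣ d ∣ ℚ.< η → ∣ u ℚ.* d ∣ ℚ.< δ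
  scaled δ B 0<δ = η , 0<η , λ u d u≤B d<η → begin-strict
    ∣ u ℚ.* d ∣        ≡⟨ ℚ.∣p*q∣≡∣p∣*∣q∣ u d ⟩
    ∣ u ∣ ℚ.* ∣ d ∣    ≤⟨ ℚ.*-monoʳ-≤-nonNeg ∣ d ∣ {{ℚ.∣-∣-nonNeg d}} u≤B ⟩
    B ℚ.* ∣ d ∣        <⟨ ℚ.*-monoʳ-<-pos B d<η ⟩
    B ℚ.* (1/B ℚ.* δ)  ≡⟨ sym (ℚ.*-assoc B 1/B δ) ⟩
    (B ℚ.* 1/B) ℚ.* δ  ≡⟨ cong (ℚ._* δ) (ℚ.*-inverseʳ B) ⟩
    1ℚ ℚ.* δ           ≡⟨ ℚ.*-identityˡ δ ⟩
    δ ∎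
    where
    open ℚ.≤-Reasoning
    instance _ = ℚ.pos⇒nonZero B
    1/B = ℚ.1/ B
    η = 1/B ℚ.* δ
    0<η : 0ℚ ℚ.< η
    0<η = subst (ℚ._< η) (ℚ.*-zeroʳ 1/B) (ℚ.*-monoʳ-<-pos 1/B {{ℚ.1/pos⇒pos B}} 0<δ)

private
  product-close : ∀ ε a b c d →
    ∣ a ℚ.* (b ℚ.- d) ∣ ℚ.< ½ ℚ.* ε → ∣ d ℚ.* (a ℚ.- c) ∣ ℚ.< ½ ℚ.* ε →
    ∣ a ℚ.* b ℚ.- c ℚ.* d ∣ ℚ.< ε
  product-close ε a b c d h₁ h₂ = begin-strict
    ∣ a ℚ.* b ℚ.- c ℚ.* d ∣
      ≡⟨ cong ∣_∣ (regroup a b c d) ⟩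
    ∣ a ℚ.* (b ℚ.- d) ℚ.+ d ℚ.* (a ℚ.- c) ∣
      ≤⟨ ℚ.∣p+q∣≤∣p∣+∣q∣ (a ℚ.* (b ℚ.- d)) (d ℚ.* (a ℚ.- c)) ⟩
    ∣ a ℚ.* (b ℚ.- d) ∣ ℚ.+ ∣ d ℚ.* (a ℚ.- c) ∣
      <⟨ ℚ.+-mono-< h₁ h₂ ⟩
    ½ ℚ.* ε ℚ.+ ½ ℚ.* ε
      ≡⟨ halves ε ⟩
    ε ∎
    where
    open ℚ.≤-Reasoning
    regroup : ∀ a b c d →
              a ℚ.* b ℚ.- c ℚ.* d ≡ a ℚ.* (b ℚ.- d) ℚ.+ d ℚ.* (a ℚ.- c)
    regroup = solve 4
      (λ a b c d → a :* b :- c :* d := a :* (b :- d) :+ d :* (a :- c)) refl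
      where open +-*-Solver

_*_ : ℝ → ℝ → ℝ
x * y = mkℝ (λ n → seq x n ℚ.* seq y n) isCauchy
  where
  isCauchy : IsCauchy (λ n → seq x n ℚ.* seq y n)
  isCauchy ε 0<ε =
    let B , B>0 , K , x≤B = eventually-bounded x
        C , C>0 , L , y≤C = eventually-bounded y
        η , 0<η , hη = scaled (½ ℚ.* ε) B {{B>0}} (half-pos 0<ε)
        θ , 0<θ , hθ = scaled (½ ℚ.* ε) C {{C>0}} (half-pos 0<ε)
        M , hM = cauchy x θ 0<θ
        N , hN = cauchy y η 0<η
        KL = K ℕ.⊔ L
        MN = M ℕ.⊔ N
    in KL ℕ.⊔ MN , λ m n ≤m ≤n →
      product-close ε (seq x m) (seq y m) (seq x n) (seq y n)
        (hη (seq x m) (seq y m ℚ.- seq y n)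
          (x≤B m (⊔-≤ˡ K L (⊔-≤ˡ KL MN ≤m)))
          (hN m n (⊔-≤ʳ M N (⊔-≤ʳ KL MN ≤m)) (⊔-≤ʳ M N (⊔-≤ʳ KL MN ≤n))))
        (hθ (seq y n) (seq x m ℚ.- seq x n)
          (y≤C n (⊔-≤ʳ K L (⊔-≤ˡ KL MN ≤n)))
          (hM m n (⊔-≤ˡ M N (⊔-≤ʳ KL MN ≤m)) (⊔-≤ˡ M N (⊔-≤ʳ KL MN ≤n))))

------------------------------------------------------------------------
-- Square roots of natural numbers

⌊√_⌋ : ℕ → ℕ
⌊√ zero ⌋ = 0
⌊√ suc n ⌋ with suc ⌊√ n ⌋ ℕ.* suc ⌊√ n ⌋ ℕ.≤? suc n
... | yes _ = suc ⌊√ n ⌋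
... | no  _ = ⌊√ n ⌋

⌊√⌋-lower : ∀ n → ⌊√ n ⌋ ℕ.* ⌊√ n ⌋ ℕ.≤ n
⌊√⌋-lower zero = ℕ.z≤n
⌊√⌋-lower (suc n) with suc ⌊√ n ⌋ ℕ.* suc ⌊√ n ⌋ ℕ.≤? suc n
... | yes r²≤n = r²≤n
... | no  _    = ℕ.m≤n⇒m≤1+n (⌊√⌋-lower n)

⌊√⌋-upper : ∀ n → n ℕ.< suc ⌊√ n ⌋ ℕ.* suc ⌊√ n ⌋
⌊√⌋-upper zero = ℕ.s≤s ℕ.z≤n
⌊√⌋-upper (suc n) with suc ⌊√ n ⌋ ℕ.* suc ⌊√ n ⌋ ℕ.≤? suc n
... | yes _    = ℕ.≤-<-trans (⌊√⌋-upper n)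
                   (ℕ.*-mono-< (ℕ.n<1+n (suc ⌊√ n ⌋)) (ℕ.n<1+n (suc ⌊√ n ⌋)))
... | no  r²≰n = ℕ.≰⇒> r²≰n

√-approx : ℕ → ℕ → ℚ
√-approx m k = + ⌊√ m ℕ.* (suc k ℕ.* suc k) ⌋ ℚ./ suc k

private
  square-reflects-< : ∀ {a b} → a ℕ.* a ℕ.< b ℕ.* b → a ℕ.< b
  square-reflects-< a²<b² = ℕ.≰⇒> λ b≤a → ℕ.<⇒≱ a²<b² (ℕ.*-mono-≤ b≤a b≤a)

  cross : ∀ m p q .{{_ : ℕ.NonZero p}} →
          ⌊√ m ℕ.* (p ℕ.* p) ⌋ ℕ.* q ℕ.< suc ⌊√ m ℕ.* (q ℕ.* q) ⌋ ℕ.* p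
  cross m p q = square-reflects-< (begin-strict
    (a ℕ.* q) ℕ.* (a ℕ.* q)
      ≡⟨ swap a q ⟩
    (a ℕ.* a) ℕ.* (q ℕ.* q)
      ≤⟨ ℕ.*-monoˡ-≤ (q ℕ.* q) (⌊√⌋-lower (m ℕ.* (p ℕ.* p))) ⟩
    m ℕ.* (p ℕ.* p) ℕ.* (q ℕ.* q)
      ≡⟨ rotate m (p ℕ.* p) (q ℕ.* q) ⟩
    m ℕ.* (q ℕ.* q) ℕ.* (p ℕ.* p)
      <⟨ ℕ.*-monoˡ-< (p ℕ.* p) {{ℕ.m*n≢0 p p}} (⌊√⌋-upper (m ℕ.* (q ℕ.* q))) ⟩
    (suc b ℕ.* suc b) ℕ.* (p ℕ.* p)
      ≡⟨ sym (swap (suc b) p) ⟩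
    (suc b ℕ.* p) ℕ.* (suc b ℕ.* p) ∎)
    where
    open ℕ.≤-Reasoning
    open ℕ.+-*-Solver
    a = ⌊√ m ℕ.* (p ℕ.* p) ⌋
    b = ⌊√ m ℕ.* (q ℕ.* q) ⌋
    swap : ∀ u v → (u ℕ.* v) ℕ.* (u ℕ.* v) ≡ (u ℕ.* u) ℕ.* (v ℕ.* v)
    swap = solve 2 (λ u v → (u :* v) :* (u :* v) := (u :* u) :* (v :* v)) refl
    rotate : ∀ u v w → u ℕ.* v ℕ.* w ≡ u ℕ.* w ℕ.* v
    rotate = solve 3 (λ u v w → u :* v :* w := u :* w :* v) refl

  /-mono-< : ∀ a b p q → a ℕ.* suc q ℕ.< b ℕ.* suc p →
             + a ℚ./ suc p ℚ.< + b ℚ./ suc q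
  /-mono-< a b p q h = ℚ.toℚᵘ-cancel-<
    (ℚᵘ.<-respˡ-≃ (ℚᵘ.≃-sym (ℚ.toℚᵘ-fromℚᵘ (ℚᵘ.mkℚᵘ (+ a) p)))
    (ℚᵘ.<-respʳ-≃ (ℚᵘ.≃-sym (ℚ.toℚᵘ-fromℚᵘ (ℚᵘ.mkℚᵘ (+ b) q)))
    (ℚᵘ.*<* (subst₂ ℤ._<_ (ℤ.pos-* a (suc q)) (ℤ.pos-* b (suc p)) (ℤ.+<+ h)))))

  suc-/ : ∀ b q → + suc b ℚ./ suc q ≡ + 1 ℚ./ suc q ℚ.+ + b ℚ./ suc q
  suc-/ b q = ℚ.toℚᵘ-injective (begin
    toℚᵘ (+ suc b ℚ./ suc q)
      ≈⟨ ℚ.toℚᵘ-fromℚᵘ (ℚᵘ.mkℚᵘ (+ suc b) q) ⟩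
    ℚᵘ.mkℚᵘ (+ suc b) q
      ≈⟨ ℚᵘ.*≡* common ⟩
    ℚᵘ.mkℚᵘ (+ 1) q ℚᵘ.+ ℚᵘ.mkℚᵘ (+ b) q
      ≈⟨ ℚᵘ.+-cong (ℚᵘ.≃-sym (ℚ.toℚᵘ-fromℚᵘ (ℚᵘ.mkℚᵘ (+ 1) q)))
                   (ℚᵘ.≃-sym (ℚ.toℚᵘ-fromℚᵘ (ℚᵘ.mkℚᵘ (+ b) q))) ⟩
    toℚᵘ (+ 1 ℚ./ suc q) ℚᵘ.+ toℚᵘ (+ b ℚ./ suc q)
      ≈⟨ ℚᵘ.≃-sym (ℚ.toℚᵘ-homo-+ (+ 1 ℚ./ suc q) (+ b ℚ./ suc q)) ⟩
    toℚᵘ (+ 1 ℚ./ suc q ℚ.+ + b ℚ./ suc q) ∎)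
    where
    open import Relation.Binary.Reasoning.Setoid ℚᵘ.≃-setoid
    Q = + suc q
    common : + suc b ℤ.* (Q ℤ.* Q) ≡ (+ 1 ℤ.* Q ℤ.+ + b ℤ.* Q) ℤ.* Q
    common = trans (sym (ℤ.*-assoc (+ suc b) Q Q))
                   (cong (ℤ._* Q) (ℤ.*-distribʳ-+ Q (+ 1) (+ b)))

  √-approx-close : ∀ m j k → √-approx m j ℚ.- √-approx m k ℚ.< + 1 ℚ./ suc k
  √-approx-close m j k = begin-strict
    s ℚ.- t
      <⟨ ℚ.+-monoˡ-< (ℚ.- t) (/-mono-< a (suc b) j k (cross m (suc j) (suc k))) ⟩
    + suc b ℚ./ suc k ℚ.- t
      ≡⟨ cong (ℚ._- t) (suc-/ b k) ⟩
    (+ 1 ℚ./ suc k ℚ.+ t) ℚ.- t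
      ≡⟨ cancel (+ 1 ℚ./ suc k) t ⟩
    + 1 ℚ./ suc k ∎
    where
    open ℚ.≤-Reasoning
    a = ⌊√ m ℕ.* (suc j ℕ.* suc j) ⌋
    b = ⌊√ m ℕ.* (suc k ℕ.* suc k) ⌋
    s = √-approx m j
    t = √-approx m k
    cancel : ∀ u v → (u ℚ.+ v) ℚ.- v ≡ u
    cancel = solve 2 (λ u v → (u :+ v) :- v := u) refl
      where open +-*-Solver

  archimedean : ∀ ε → 0ℚ ℚ.< ε → ∃[ N ] ∀ k → N ℕ.≤ k → + 1 ℚ./ suc k ℚ.< ε
  archimedean ε@(mkℚ +[1+ n ] d _) _ = suc d , λ k d<k →
    subst (+ 1 ℚ./ suc k ℚ.<_) (ℚ.↥p/↧p≡p ε)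
      (/-mono-< 1 (suc n) k d (begin-strict
        1 ℕ.* suc d      ≡⟨ ℕ.*-identityˡ (suc d) ⟩
        suc d            <⟨ ℕ.s≤s d<k ⟩
        suc k            ≤⟨ ℕ.m≤n*m (suc k) (suc n) ⟩
        suc n ℕ.* suc k  ∎))
    where open ℕ.≤-Reasoning
  archimedean (mkℚ (+ 0) d _) (ℚ.*<* (ℤ.+<+ ()))
  archimedean (mkℚ ℤ.-[1+ n ] d _) (ℚ.*<* ())

  ∣-∣-< : ∀ p q {ε} → p ℚ.- q ℚ.< ε → q ℚ.- p ℚ.< ε → ∣ p ℚ.- q ∣ ℚ.< ε
  ∣-∣-< p q {ε} h₁ h₂ with ℚ.∣p∣≡p∨∣p∣≡-p (p ℚ.- q)
  ... | inj₁ eq = subst (ℚ._< ε) (sym eq) h₁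
  ... | inj₂ eq = subst (ℚ._< ε) (sym (trans eq (flip p q))) h₂
    where
    flip : ∀ u v → ℚ.- (u ℚ.- v) ≡ v ℚ.- u
    flip = solve 2 (λ u v → :- (u :- v) := v :- u) refl
      where open +-*-Solver

-- The k-th approximation is ⌊√(m (k+1)²)⌋ / (k+1), which lies within
-- 1/(k+1) below the nonnegative square root of m.
√_ : ℕ → ℝ
√ m = mkℝ (√-approx m) isCauchy
  where
  isCauchy : IsCauchy (√-approx m)
  isCauchy ε 0<ε with archimedean ε 0<ε
  ... | N , h = N , λ j k N≤j N≤k → ∣-∣-< (√-approx m j) (√-approx m k)
    (ℚ.<-trans (√-approx-close m j k) (h k N≤k))
    (ℚ.<-trans (√-approx-close m k j) (h j N≤j))

------------------------------------------------------------------------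
-- Eigenvalues of real square matrices

Matrix : ℕ → Set
Matrix n = Fin n → Fin n → ℝ

infixr 7 _·_

_·_ : ∀ {n} → Matrix n → Vector ℝ n → Vector ℝ n
(A · x) i = foldr _+_ 0ℝ (λ j → A i j * x j)

IsEigenvalue : ∀ {n} → Matrix n → ℝ → Set
IsEigenvalue {n} A μ = ∃[ x ] ¬ (∀ i → x i ≈ 0ℝ) × (∀ i → (A · x) i ≈ μ * x i)

IsLargestEigenvalue : ∀ {n} → Matrix n → ℝ → Set
IsLargestEigenvalue A ρ = IsEigenvalue A ρ × (∀ μ → IsEigenvalue A μ → μ ≤ ρ)

------------------------------------------------------------------------
-- Finite simple graphs

record Graph (n : ℕ) : Set₁ where
  field
    Adj    : Fin n → Fin n → Set
    adj?   : Decidable Adj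
    symm   : Symmetric Adj
    irrefl : Irreflexive _≡_ Adj

module _ {n : ℕ} (G : Graph n) where
  open Graph G

  Connected : Set
  Connected = ∀ u v → Star Adj u v

  NoIsolatedVertices : Set
  NoIsolatedVertices = ∀ u → ∃[ v ] Adj u v

  -- Each edge is listed once, as the pair of its ends in increasing order.
  edges : List (Fin n × Fin n)
  edges = filter (λ (u , v) → u F.<? v ×-dec adj? u v)
                 (cartesianProduct (allFin n) (allFin n))

  #edges : ℕ
  #edges = length edges

  adjacencyMatrix : Matrix n
  adjacencyMatrix u v = if does (adj? u v) then 1ℝ else 0ℝ

  IsSpectralRadius : ℝ → Set
  IsSpectralRadius ρ = IsLargestEigenvalue adjacencyMatrix ρ

-- H is isomorphic to a (not necessarily induced) subgraph of G.
_⊑_ : ∀ {h n} → Graph h → Graph n → Set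
_⊑_ {h} {n} H G = Σ (Fin h → Fin n) λ f → Injective _≡_ _≡_ f ×
  (∀ {u v} → Graph.Adj H u v → Graph.Adj G (f u) (f v))

-- Vertices 0 and 1 span the common edge; each of the other k vertices
-- is adjacent to exactly these two.
book : ∀ k → Graph (2 ℕ.+ k)
book k = record
  { Adj    = λ u v → u ≢ v × (toℕ u ℕ.< 2 ⊎ toℕ v ℕ.< 2)
  ; adj?   = λ u v → ¬? (u F.≟ v) ×-dec (toℕ u ℕ.<? 2 ⊎-dec toℕ v ℕ.<? 2)
  ; symm   = λ (u≢v , s) → u≢v ∘ sym , Sum.swap s
  ; irrefl = λ u≡v (u≢v , _) → u≢v u≡v
  }

-- The greatest k ≥ 1 with book k ⊑ G, or 0 if there is no such k
-- (that is, if G is triangle-free).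
IsBooksize : ∀ {n} → Graph n → ℕ → Set
IsBooksize G b =
  (b ≡ 0 ⊎ book b ⊑ G) × (∀ k → 1 ℕ.≤ k → book k ⊑ G → k ℕ.≤ b)

-- Let b bound the number of common neighbours of the ends of an edge, and
-- let x ≥ 0 satisfy r x ≤ A x with r² > m and r ≥ 9b. Put y = A x / r ≥ x,
-- scaled so that its maximum is y u = 1, let N be the neighbourhood of u,
-- W its complement, and D z the number of neighbours of z in N. Expanding
-- r² = r Σ_N x ≤ Σ_N A x = Σ_z D z x z and subtracting m gives
--   e(N) + e(W) + Σ_W D (1 - y) < Σ_N D x,
-- that is, the edges vw inside N have a positive total excess
-- x v + x w - 1 that outweighs e(W) and the deficits 1 - y z on W. Now
-- r (1 - y z) is, up to edges inside W, the weight x of the vertices of N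
-- not adjacent to z; truncating D at r/2 lets e(W) absorb those edges. The
-- ends of an edge vw inside N have few common neighbours, so together they
-- miss almost all of W, and when x v + x w > 1 the set W is heavy. Hence the
-- deficit charged to v and w exceeds the excess x v + x w - 1 ≤ min (x v, x w),
-- a contradiction.
module Submission where

import Defs
open import Data.Nat as ℕ using (ℕ)
import Data.Nat.Properties as ℕ

module RationalEstimates where

  open Defs using
    ( ℝ; seq; 0ℝ; √_; ⌊√_⌋; ⌊√⌋-lower; ⌊√⌋-upper; √-approx; _·_
    ; Graph; #edges; book; _⊑_; IsBooksize )
  open import Algebra.Bundles using (CommutativeRing)
  open import Data.Bool using (Bool; true; false; if_then_else_; _∧_)
  open import Data.Empty using (⊥; ⊥-elim)
  open import Data.Fin as F using (Fin; zero; suc)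
  import Data.Fin.Properties as F
  import Data.Integer as ℤ
  import Data.Integer.Properties as ℤ
  open import Data.List
    using (List; []; _∷_; _++_; map; length; filter; allFin; tabulate; cartesianProduct; lookup)
  import Data.List.Membership.Propositional.Properties as ∈
  import Data.List.Relation.Unary.All as All
  import Data.List.Relation.Unary.All.Properties as All
  open import Data.List.Relation.Unary.Unique.Propositional using (Unique; []; _∷_)
  import Data.List.Relation.Unary.Unique.Propositional.Properties as Unique
  open import Data.Nat using (zero; suc)
  open import Data.Product using (_×_; _,_; ∃-syntax; proj₁; proj₂)
  open import Data.Rational
  open import Data.Rational.Properties
  open import Data.Rational.Solver using (module +-*-Solver)
  import Data.Rational.Unnormalised as ℚᵘ
  import Data.Rational.Unnormalised.Properties as ℚᵘ
  open import Data.Sum using (_⊎_; inj₁; inj₂)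
  open import Data.Vec.Functional using (Vector; foldr)
  open import Function using (_∘_; id)
  open import Function.Definitions using (Injective)
  open import Relation.Binary.Definitions using (tri<; tri≈; tri>)
  open import Relation.Binary.PropositionalEquality
  open import Relation.Nullary using (does; yes; no; ¬_; _×-dec_)
  open import Relation.Nullary.Decidable using (dec-true; dec-false)
  open import Relation.Unary using (Pred; Decidable)
  open import Algebra.Properties.Semiring.Sum (CommutativeRing.semiring +-*-commutativeRing)
  open +-*-Solver

  -- Inequalities over ℚ

  diff≥0 : ∀ {p q} → p ≤ q → 0ℚ ≤ q - p
  diff≥0 {p} {q} p≤q = subst (_≤ q - p) (+-inverseʳ p) (+-monoˡ-≤ (- p) p≤q)

  diff>0 : ∀ {p q} → p < q → 0ℚ < q - p
  diff>0 {p} {q} p<q = subst (_< q - p) (+-inverseʳ p) (+-monoˡ-< (- p) p<q)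

  private
    re-add : ∀ p q → (q - p) + p ≡ q
    re-add = solve 2 (λ p q → (q :- p) :+ p := q) refl

  ≤-by : ∀ {p q d} → 0ℚ ≤ d → q - p ≡ d → p ≤ q
  ≤-by {p} {q} 0≤d refl = subst₂ _≤_ (+-identityˡ p) (re-add p q) (+-monoˡ-≤ p 0≤d)

  <-by : ∀ {p q d} → 0ℚ < d → q - p ≡ d → p < q
  <-by {p} {q} 0<d refl = subst₂ _<_ (+-identityˡ p) (re-add p q) (+-monoˡ-< p 0<d)

  -- An inequality p ≤ q is proved by a ring identity q - p ≡ d, where d is a
  -- sum of products of terms known to be nonnegative, assembled by ⊕ and ⊗.
  infixl 6 _⊕_ _⊞_
  infixl 7 _⊗_ _⊠_

  _⊕_ : ∀ {p q} → 0ℚ ≤ p → 0ℚ ≤ q → 0ℚ ≤ p + q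
  _⊕_ = +-mono-≤

  _⊞_ : ∀ {p q} → 0ℚ < p → 0ℚ ≤ q → 0ℚ < p + q
  _⊞_ = +-mono-<-≤

  _⊗_ : ∀ {p q} → 0ℚ ≤ p → 0ℚ ≤ q → 0ℚ ≤ p * q
  _⊗_ {p} {q} 0≤p 0≤q =
    nonNegative⁻¹ (p * q) {{nonNeg*nonNeg⇒nonNeg p {{nonNegative 0≤p}} q {{nonNegative 0≤q}}}}

  _⊠_ : ∀ {p q} → 0ℚ < p → 0ℚ < q → 0ℚ < p * q
  _⊠_ {p} {q} 0<p 0<q =
    positive⁻¹ (p * q) {{pos*pos⇒pos p {{positive 0<p}} q {{positive 0<q}}}}

  0≤1 : 0ℚ ≤ 1ℚ
  0≤1 = nonNegative⁻¹ 1ℚ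

  0≤½ : 0ℚ ≤ ½
  0≤½ = nonNegative⁻¹ ½

  sum-mono : ∀ {n} {f g : Vector ℚ n} → (∀ i → f i ≤ g i) → sum f ≤ sum g
  sum-mono {zero}  f≤g = ≤-refl
  sum-mono {suc n} f≤g = +-mono-≤ (f≤g zero) (sum-mono (f≤g ∘ suc))

  sum-nonNeg : ∀ {n} {f : Vector ℚ n} → (∀ i → 0ℚ ≤ f i) → 0ℚ ≤ sum f
  sum-nonNeg {zero}  0≤f = ≤-refl
  sum-nonNeg {suc n} 0≤f = 0≤f zero ⊕ sum-nonNeg (0≤f ∘ suc)

  sum-scale : ∀ {n} c (f : Vector ℚ n) → sum (λ i → c * f i) ≡ c * sum f
  sum-scale c f = sym (*-distribˡ-sum c f)

  argmax : ∀ {n} → Fin n → (f : Vector ℚ n) → ∃[ i ] ∀ j → f j ≤ f i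
  argmax {1}           _ f = zero , λ { zero → ≤-refl }
  argmax {suc (suc n)} _ f with argmax zero (f ∘ suc)
  ... | i , max with ≤-total (f zero) (f (suc i))
  ...   | inj₁ f₀≤ = suc i , λ { zero → f₀≤ ; (suc j) → max j }
  ...   | inj₂ f₀≥ = zero  , λ { zero → ≤-refl ; (suc j) → ≤-trans (max j) f₀≥ }

  sum-minus : ∀ {n} (f g : Vector ℚ n) → sum (λ i → f i - g i) ≡ sum f - sum g
  sum-minus {zero}  f g = refl
  sum-minus {suc n} f g = trans (cong (f zero - g zero +_) (sum-minus (f ∘ suc) (g ∘ suc)))
    (solve 4 (λ p q s t → (p :- q) :+ (s :- t) := (p :+ s) :- (q :+ t)) refl
      (f zero) (g zero) (sum (f ∘ suc)) (sum (g ∘ suc)))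

  -- Almost eigenvectors of graphs with small codegrees

  01⇒0≤ : ∀ {s} → s ≡ 0ℚ ⊎ s ≡ 1ℚ → 0ℚ ≤ s
  01⇒0≤ (inj₁ refl) = ≤-refl
  01⇒0≤ (inj₂ refl) = 0≤1

  01⇒≤1 : ∀ {s} → s ≡ 0ℚ ⊎ s ≡ 1ℚ → s ≤ 1ℚ
  01⇒≤1 (inj₁ refl) = 0≤1
  01⇒≤1 (inj₂ refl) = ≤-refl

  -- Edge hypotheses, such as the codegree bound, are available only where an indicator is 1;
  -- elsewhere the product vanishes.
  guard-nonNeg : ∀ {s p} → s ≡ 0ℚ ⊎ s ≡ 1ℚ → (s ≡ 1ℚ → 0ℚ ≤ p) → 0ℚ ≤ s * p
  guard-nonNeg {p = p} (inj₁ refl) _   = ≤-reflexive (sym (*-zeroˡ p))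
  guard-nonNeg {p = p} (inj₂ refl) 0≤p = subst (0ℚ ≤_) (sym (*-identityˡ p)) (0≤p refl)

  guard : ∀ {s p q} → s ≡ 0ℚ ⊎ s ≡ 1ℚ → (s ≡ 1ℚ → p ≤ q) → s * p ≤ s * q
  guard {p = p} {q} (inj₁ refl) _   = ≤-reflexive (trans (*-zeroˡ p) (sym (*-zeroˡ q)))
  guard {p = p} {q} (inj₂ refl) p≤q =
    subst₂ _≤_ (sym (*-identityˡ p)) (sym (*-identityˡ q)) (p≤q refl)

  -- The vector stands to the left of the matrix entry so that applying `a` to its own row `a u`
  -- unfolds to the very codegree sum that `codegree≤b` bounds.
  apply : ∀ {n} → (Fin n → Fin n → ℚ) → Vector ℚ n → Vector ℚ n
  apply {n} a f i = ∑[ j < n ] (f j * a i j)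

  module SmallCodegree
    {n : ℕ} (a : Fin n → Fin n → ℚ) (m b : ℚ)
    (a-01  : ∀ i j → a i j ≡ 0ℚ ⊎ a i j ≡ 1ℚ)
    (a-sym : ∀ i j → a i j ≡ a j i)
    (size : ∑[ i < n ] ∑[ j < n ] a i j ≡ m + m)
    (codegree≤b : ∀ i j → a i j ≡ 1ℚ → ∑[ k < n ] (a i k * a j k) ≤ b)
    where

    A : Vector ℚ n → Vector ℚ n
    A = apply a

    A-cong : ∀ {f g} i → (∀ j → f j ≡ g j) → A f i ≡ A g i
    A-cong i f≗g = sum-cong-≗ λ j → cong (_* a i j) (f≗g j)

    A-+ : ∀ f g i → A (λ j → f j + g j) i ≡ A f i + A g i
    A-+ f g i = trans (sum-cong-≗ λ j → *-distribʳ-+ (a i j) (f j) (g j))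
                      (∑-distrib-+ (λ j → f j * a i j) (λ j → g j * a i j))

    A-mono : ∀ {f g} i → (∀ j → f j ≤ g j) → A f i ≤ A g i
    A-mono i f≤g = sum-mono λ j →
      *-monoʳ-≤-nonNeg (a i j) {{nonNegative (01⇒0≤ (a-01 i j))}} (f≤g j)

    A-nonNeg : ∀ {f} i → (∀ j → 0ℚ ≤ f j) → 0ℚ ≤ A f i
    A-nonNeg i 0≤f = sum-nonNeg λ j → 0≤f j ⊗ 01⇒0≤ (a-01 i j)

    -- By symmetry of `a`. It serves as double counting: a sum of `A f` over a vertex set becomes a
    -- sum of `f` weighted by the number of neighbours in that set.
    A-selfAdjoint : ∀ f g → ∑[ i < n ] (f i * A g i) ≡ ∑[ i < n ] (g i * A f i)
    A-selfAdjoint f g = begin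
      ∑[ i < n ] (f i * A g i)
        ≡⟨ sum-cong-≗ (λ i → *-distribˡ-sum (f i) (λ j → g j * a i j)) ⟩
      ∑[ i < n ] ∑[ j < n ] (f i * (g j * a i j))
        ≡⟨ ∑-comm (λ i j → f i * (g j * a i j)) ⟩
      ∑[ j < n ] ∑[ i < n ] (f i * (g j * a i j))
        ≡⟨ sum-cong-≗ (λ j → sum-cong-≗ (λ i →
             trans (exchange (f i) (g j) (a i j)) (cong (λ t → g j * (f i * t)) (a-sym i j)))) ⟩
      ∑[ j < n ] ∑[ i < n ] (g j * (f i * a j i))
        ≡⟨ sum-cong-≗ (λ j → *-distribˡ-sum (g j) (λ i → f i * a j i)) ⟨
      ∑[ j < n ] (g j * A f j) ∎
      where
      open ≡-Reasoning
      exchange : ∀ p q s → p * (q * s) ≡ q * (p * s)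
      exchange = solve 3 (λ p q s → p :* (q :* s) := q :* (p :* s)) refl

    -- The equation for y carries an error κ, since x will be a rational
    -- approximation to an eigenvector.
    module AlmostEigenvector
      (u : Fin n) (x y : Vector ℚ n) (r κ e : ℚ)
      (0≤x : ∀ i → 0ℚ ≤ x i) (x≤y : ∀ i → x i ≤ y i) (y≤1 : ∀ i → y i ≤ 1ℚ) (yᵤ≡1 : y u ≡ 1ℚ)
      (ry≡Ax+κ : ∀ i → r * y i ≡ A x i + κ)
      (0<r : 0ℚ < r) (0≤κ : 0ℚ ≤ κ) (e≤1 : e ≤ 1ℚ)
      (m+er≤r² : m + e * r ≤ r * r)
      (κ-small : (∑[ i < n ] 1ℚ + (r + r)) * κ < e * r)
      where

      ν = ∑[ i < n ] 1ℚ

      N W D E c s K : Vector ℚ n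
      N i = a u i
      W i = 1ℚ - N i
      D = A N
      E = A W
      c i = D i ⊓ (½ * r)
      s i = W i * c i
      C = sum s
      K i = C - A s i

      -- P = 2e(N), Q = e(N, W) and R = 2e(W).
      S P Q R α G : ℚ
      S = ∑[ i < n ] (N i * x i)
      P = ∑[ i < n ] (N i * D i)
      Q = ∑[ i < n ] (W i * D i)
      R = ∑[ i < n ] (W i * E i)
      α = ∑[ i < n ] (N i * (D i * x i))
      G = ∑[ i < n ] (s i * (1ℚ - y i))

      -- Signs and sizes of the weights

      0≤r : 0ℚ ≤ r
      0≤r = <⇒≤ 0<r

      x≤1 : ∀ i → x i ≤ 1ℚ
      x≤1 i = ≤-trans (x≤y i) (y≤1 i)

      0≤N : ∀ i → 0ℚ ≤ N i
      0≤N i = 01⇒0≤ (a-01 u i)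

      0≤W : ∀ i → 0ℚ ≤ W i
      0≤W i = diff≥0 (01⇒≤1 (a-01 u i))

      W≤1 : ∀ i → W i ≤ 1ℚ
      W≤1 i = ≤-by (0≤N i) (solve 1 (λ p → con 1ℚ :- (con 1ℚ :- p) := p) refl (N i))

      0≤D : ∀ i → 0ℚ ≤ D i
      0≤D i = A-nonNeg i 0≤N

      0≤E : ∀ i → 0ℚ ≤ E i
      0≤E i = A-nonNeg i 0≤W

      c≤D : ∀ i → c i ≤ D i
      c≤D i = p⊓q≤p (D i) (½ * r)

      c≤½r : ∀ i → c i ≤ ½ * r
      c≤½r i = p⊓q≤q (D i) (½ * r)

      0≤c : ∀ i → 0ℚ ≤ c i
      0≤c i = ⊓-glb (0≤D i) (0≤½ ⊗ 0≤r)

      0≤s : ∀ i → 0ℚ ≤ s i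
      0≤s i = 0≤W i ⊗ 0≤c i

      split : ∀ (f : Vector ℚ n) → sum f ≡ ∑[ i < n ] (N i * f i) + ∑[ i < n ] (W i * f i)
      split f = trans
        (sum-cong-≗ λ i → solve 2 (λ p q → q := p :* q :+ (con 1ℚ :- p) :* q) refl (N i) (f i))
        (∑-distrib-+ (λ i → N i * f i) (λ i → W i * f i))

      Ax≡ : ∀ i → A x i ≡ r * y i - κ
      Ax≡ i = trans (solve 2 (λ p κ → p := (p :+ κ) :- κ) refl (A x i) κ)
                    (cong (_- κ) (sym (ry≡Ax+κ i)))

      -- Comparison of r² with the number of edges

      r≡S+κ : r ≡ S + κ
      r≡S+κ = begin
        r              ≡⟨ *-identityʳ r ⟨
        r * 1ℚ         ≡⟨ cong (r *_) yᵤ≡1 ⟨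
        r * y u        ≡⟨ ry≡Ax+κ u ⟩
        A x u + κ      ≡⟨ cong (_+ κ) (sum-cong-≗ λ i → *-comm (x i) (N i)) ⟩
        S + κ          ∎
        where open ≡-Reasoning

      S≤r : S ≤ r
      S≤r = ≤-by 0≤κ (trans (cong (_- S) r≡S+κ) (solve 2 (λ S κ → S :+ κ :- S := κ) refl S κ))

      -- Sum r x ≤ r y = A x + κ over N and move A from x to the indicator of N; the error κ enters
      -- at most ν times.
      rS≤ : r * S ≤ ∑[ i < n ] (x i * D i) + ν * κ
      rS≤ = begin
        r * S
          ≡⟨ *-distribˡ-sum r (λ i → N i * x i) ⟩
        ∑[ i < n ] (r * (N i * x i))
          ≤⟨ sum-mono (λ i → ≤-by
               (0≤N i ⊗ (0≤r ⊗ diff≥0 (x≤y i)) ⊕ diff≥0 (01⇒≤1 (a-01 u i)) ⊗ 0≤κ)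
               (trans (cong (λ t → N i * t + 1ℚ * κ - r * (N i * x i)) (Ax≡ i))
                  (solve 5 (λ r N x y κ →
                    N :* (r :* y :- κ) :+ con 1ℚ :* κ :- r :* (N :* x) :=
                    N :* (r :* (y :- x)) :+ (con 1ℚ :- N) :* κ)
                    refl r (N i) (x i) (y i) κ))) ⟩
        ∑[ i < n ] (N i * A x i + 1ℚ * κ)
          ≡⟨ ∑-distrib-+ (λ i → N i * A x i) (λ i → 1ℚ * κ) ⟩
        ∑[ i < n ] (N i * A x i) + ∑[ i < n ] (1ℚ * κ)
          ≡⟨ cong₂ _+_ (A-selfAdjoint N x) (sym (*-distribʳ-sum κ (λ (i : Fin n) → 1ℚ))) ⟩
        ∑[ i < n ] (x i * D i) + ν * κ ∎
        where open ≤-Reasoning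

      -- By the equation at u, r² = r S + r κ, and r S is bounded by `rS≤`. The total error (ν + r)
      -- κ is below e r, the amount by which r² is known to exceed m.
      m<xD : m < ∑[ i < n ] (x i * D i)
      m<xD = <-by (diff>0 κ-small ⊞ diff≥0 rS≤ ⊞ diff≥0 m+er≤r² ⊞ 0≤r ⊗ 0≤κ)
        (begin
          T - m
            ≡⟨ solve 4 (λ T m X Y → T :- m := T :- m :+ (X :* Y :- X :* Y)) refl T m r r ⟩
          T - m + (r * r - r * r)
            ≡⟨ cong (λ t → T - m + (r * r - r * t)) r≡S+κ ⟩
          T - m + (r * r - r * (S + κ))
            ≡⟨ solve 7 (λ T m r S κ e ν →
                 T :- m :+ (r :* r :- r :* (S :+ κ)) :=
                 (e :* r :- (ν :+ (r :+ r)) :* κ) :+ (T :+ ν :* κ :- r :* S)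
                   :+ (r :* r :- (m :+ e :* r)) :+ r :* κ)
                 refl T m r S κ e ν ⟩
          (e * r - (ν + (r + r)) * κ) + (T + ν * κ - r * S) + (r * r - (m + e * r)) + r * κ ∎)
        where
        open ≡-Reasoning
        T = ∑[ i < n ] (x i * D i)

      NE≡Q : ∑[ i < n ] (N i * E i) ≡ Q
      NE≡Q = A-selfAdjoint N W

      -- Split both ends of the ordered adjacent pairs between N and W; the mixed pairs give Q in
      -- each order.
      2m≡P+2Q+R : m + m ≡ P + Q + (Q + R)
      2m≡P+2Q+R = begin
        m + m
          ≡⟨ size ⟨
        ∑[ i < n ] ∑[ j < n ] a i j
          ≡⟨ sum-cong-≗ (λ i → trans
               (sum-cong-≗ λ j → solve 2 (λ p q → q := p :* q :+ (con 1ℚ :- p) :* q) refl (N j) (a i j))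
               (∑-distrib-+ (λ j → N j * a i j) (λ j → W j * a i j))) ⟩
        ∑[ i < n ] (D i + E i)
          ≡⟨ ∑-distrib-+ D E ⟩
        sum D + sum E
          ≡⟨ cong₂ _+_ (split D) (split E) ⟩
        P + Q + (∑[ i < n ] (N i * E i) + R)
          ≡⟨ cong (λ t → P + Q + (t + R)) NE≡Q ⟩
        P + Q + (Q + R) ∎
        where open ≡-Reasoning

      xD≡ : ∑[ i < n ] (x i * D i) ≡ α + ∑[ i < n ] (W i * (D i * x i))
      xD≡ = trans (sum-cong-≗ λ i → *-comm (x i) (D i)) (split λ i → D i * x i)

      -- On W, c ≤ D and x ≤ y give c (1 - y) + D x ≤ D (1 - y) + D y = D.
      deficit : ∑[ i < n ] (s i * (1ℚ - y i)) + ∑[ i < n ] (W i * (D i * x i)) ≤ Q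
      deficit = begin
        ∑[ i < n ] (s i * (1ℚ - y i)) + ∑[ i < n ] (W i * (D i * x i))
          ≡⟨ ∑-distrib-+ (λ i → s i * (1ℚ - y i)) (λ i → W i * (D i * x i)) ⟨
        ∑[ i < n ] (s i * (1ℚ - y i) + W i * (D i * x i))
          ≤⟨ sum-mono (λ i → ≤-by
               (0≤W i ⊗ (diff≥0 (c≤D i) ⊗ diff≥0 (y≤1 i) ⊕ 0≤D i ⊗ diff≥0 (x≤y i)))
               (solve 5 (λ W D c x y →
                 W :* D :- (W :* c :* (con 1ℚ :- y) :+ W :* (D :* x)) :=
                 W :* ((D :- c) :* (con 1ℚ :- y) :+ D :* (y :- x)))
                 refl (W i) (D i) (c i) (x i) (y i))) ⟩
        Q ∎
        where open ≤-Reasoning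

      -- Double `m<xD` and subtract the edge count: `deficit` cancels both copies of Q. Here α - P/2
      -- is the sum of x v + x w - 1 over the edges vw inside N, since a vertex of N lies on D of
      -- them.
      excess : P + R + (G + G) < α + α
      excess = <-by (diff>0 m<xD ⊞ <⇒≤ (diff>0 m<xD) ⊞ (diff≥0 deficit ⊕ diff≥0 deficit))
        (begin
          α + α - (P + R + (G + G))
            ≡⟨ solve 6 (λ α P Q R G B →
                 α :+ α :- (P :+ R :+ (G :+ G)) :=
                 (α :+ B) :+ (α :+ B) :- (P :+ Q :+ (Q :+ R)) :+ ((Q :- (G :+ B)) :+ (Q :- (G :+ B))))
                 refl α P Q R G B ⟩
          (α + B) + (α + B) - (P + Q + (Q + R)) + ((Q - (G + B)) + (Q - (G + B)))
            ≡⟨ cong₂ (λ t t′ → t + t - t′ + ((Q - (G + B)) + (Q - (G + B)))) (sym xD≡) (sym 2m≡P+2Q+R) ⟩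
          T + T - (m + m) + ((Q - (G + B)) + (Q - (G + B)))
            ≡⟨ solve 3 (λ T m Z → T :+ T :- (m :+ m) :+ Z := (T :- m) :+ (T :- m) :+ Z) refl T m _ ⟩
          (T - m) + (T - m) + ((Q - (G + B)) + (Q - (G + B))) ∎)
        where
        open ≡-Reasoning
        T = ∑[ i < n ] (x i * D i)
        B = ∑[ i < n ] (W i * (D i * x i))

      -- For i in N, its neighbours in N are the common neighbours of the ends of the edge ui.
      ND≤Nb : ∀ i → N i * D i ≤ N i * b
      ND≤Nb i = guard (a-01 u i) (codegree≤b u i)

      α≤bS : α ≤ b * S
      α≤bS = begin
        α
          ≤⟨ sum-mono (λ i → ≤-by (0≤x i ⊗ diff≥0 (ND≤Nb i))
               (solve 4 (λ N D b x → b :* (N :* x) :- N :* (D :* x) := x :* (N :* b :- N :* D))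
                 refl (N i) (D i) b (x i))) ⟩
        ∑[ i < n ] (b * (N i * x i))
          ≡⟨ sum-scale b (λ i → N i * x i) ⟩
        b * S ∎
        where open ≤-Reasoning

      α≤P : α ≤ P
      α≤P = sum-mono λ i → ≤-by (0≤N i ⊗ (0≤D i ⊗ diff≥0 (x≤1 i)))
        (solve 3 (λ N D x → N :* D :- N :* (D :* x) := N :* (D :* (con 1ℚ :- x))) refl (N i) (D i) (x i))

      0≤G : 0ℚ ≤ G
      0≤G = sum-nonNeg λ i → 0≤s i ⊗ diff≥0 (y≤1 i)

      0≤R : 0ℚ ≤ R
      0≤R = sum-nonNeg λ i → 0≤W i ⊗ 0≤E i

      -- Since α ≤ P, `excess` leaves R + 2G < α, and α ≤ bS.
      R<bS : R < b * S
      R<bS = <-by (diff>0 excess ⊞ (0≤G ⊕ 0≤G) ⊞ diff≥0 α≤P ⊞ diff≥0 α≤bS)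
        (solve 5 (λ R bS P α G →
          bS :- R := (α :+ α :- (P :+ R :+ (G :+ G))) :+ (G :+ G) :+ (P :- α) :+ (bS :- α))
          refl R (b * S) P α G)

      -- Otherwise bS ≤ 0 ≤ R, against `R<bS`. This settles the triangle-free case.
      0<b : 0ℚ < b
      0<b = *-cancelʳ-<-nonNeg S {{nonNegative 0≤S}} (subst (_< b * S) (sym (*-zeroˡ S)) (≤-<-trans 0≤R R<bS))
        where
        0≤S : 0ℚ ≤ S
        0≤S = sum-nonNeg λ i → 0≤N i ⊗ 0≤x i

      R≤br : R ≤ b * r
      R≤br = ≤-trans (<⇒≤ R<bS) (*-monoˡ-≤-nonNeg b {{nonNegative (<⇒≤ 0<b)}} S≤r)

      -- K j is the s-weight of the vertices not adjacent to j. The term ½ r R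
      -- from the edges inside W cancels the R in excess, which is why c is
      -- truncated at ½ r.
      NxK≤ : ∑[ i < n ] (N i * x i * K i) ≤ r * G + ½ * r * R
      NxK≤ = begin
        ∑[ i < n ] (N i * x i * K i)
          ≡⟨ sum-cong-≗ (λ i → solve 3 (λ p C q → p :* (C :- q) := C :* p :- p :* q) refl (N i * x i) C (A s i)) ⟩
        ∑[ i < n ] (C * (N i * x i) - N i * x i * A s i)
          ≡⟨ sum-minus (λ i → C * (N i * x i)) (λ i → N i * x i * A s i) ⟩
        ∑[ i < n ] (C * (N i * x i)) - ∑[ i < n ] (N i * x i * A s i)
          ≡⟨ cong₂ _-_ (sum-scale C (λ i → N i * x i)) (A-selfAdjoint Nx s) ⟩
        C * S - ∑[ i < n ] (s i * A Nx i)
          ≡⟨ cong (_- ∑[ i < n ] (s i * A Nx i)) (*-distribʳ-sum S s) ⟩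
        ∑[ i < n ] (s i * S) - ∑[ i < n ] (s i * A Nx i)
          ≡⟨ sum-minus (λ i → s i * S) (λ i → s i * A Nx i) ⟨
        ∑[ i < n ] (s i * S - s i * A Nx i)
          ≡⟨ sum-cong-≗ pointwise ⟩
        ∑[ i < n ] (r * (s i * (1ℚ - y i)) + s i * A Wx i)
          ≡⟨ ∑-distrib-+ (λ i → r * (s i * (1ℚ - y i))) (λ i → s i * A Wx i) ⟩
        ∑[ i < n ] (r * (s i * (1ℚ - y i))) + ∑[ i < n ] (s i * A Wx i)
          ≤⟨ +-mono-≤ (≤-reflexive (sum-scale r (λ i → s i * (1ℚ - y i)))) sAWx≤ ⟩
        r * G + ½ * r * R ∎
        where
        open ≤-Reasoning
        Nx Wx : Vector ℚ n
        Nx i = N i * x i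
        Wx i = W i * x i

        Ax-split : ∀ i → A x i ≡ A Nx i + A Wx i
        Ax-split i = trans
          (A-cong i λ j → solve 2 (λ p q → q := p :* q :+ (con 1ℚ :- p) :* q) refl (N j) (x j))
          (A-+ Nx Wx i)

        pointwise : ∀ i → s i * S - s i * A Nx i ≡ r * (s i * (1ℚ - y i)) + s i * A Wx i
        pointwise i = sym (trans
          (solve 4 (λ r s y w → r :* (s :* (con 1ℚ :- y)) :+ s :* w := s :* r :- s :* (r :* y) :+ s :* w)
            refl r (s i) (y i) (A Wx i))
          (trans
            (cong₂ (λ p q → s i * p - s i * q + s i * A Wx i) r≡S+κ
              (trans (ry≡Ax+κ i) (cong (_+ κ) (Ax-split i))))
            (solve 5 (λ s S κ p q →
               s :* (S :+ κ) :- s :* (p :+ q :+ κ) :+ s :* q := s :* S :- s :* p)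
               refl (s i) S κ (A Nx i) (A Wx i))))

        Wx≤W : ∀ i → Wx i ≤ W i
        Wx≤W i = ≤-by (0≤W i ⊗ diff≥0 (x≤1 i))
          (solve 2 (λ p q → p :- p :* q := p :* (con 1ℚ :- q)) refl (W i) (x i))

        sAWx≤ : ∑[ i < n ] (s i * A Wx i) ≤ ½ * r * R
        sAWx≤ = begin
          ∑[ i < n ] (s i * A Wx i)
            ≤⟨ sum-mono (λ i → ≤-by
                 (0≤W i ⊗ (diff≥0 (c≤½r i) ⊗ 0≤E i ⊕ 0≤c i ⊗ diff≥0 (A-mono i Wx≤W)))
                 (solve 5 (λ W h c E t →
                   h :* (W :* E) :- W :* c :* t := W :* ((h :- c) :* E :+ c :* (E :- t)))
                   refl (W i) (½ * r) (c i) (E i) (A Wx i))) ⟩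
          ∑[ i < n ] (½ * r * (W i * E i))
            ≡⟨ sum-scale (½ * r) (λ i → W i * E i) ⟩
          ½ * r * R ∎

      -- Weight missed by the ends of an edge inside N

      0≤K : ∀ i → 0ℚ ≤ K i
      0≤K i = diff≥0 (sum-mono λ j → ≤-by (0≤s j ⊗ diff≥0 (01⇒≤1 (a-01 i j)))
        (solve 2 (λ s a → s :- s :* a := s :* (con 1ℚ :- a)) refl (s j) (a i j)))

      -- If c = D, then r x ≤ r y = A x + κ ≤ D + E + κ. If c = r/2, then 2c = r ≥ r x. The factor 2
      -- pays for the truncation.
      2c≥ : ∀ i → r * x i - E i - κ ≤ c i + c i
      2c≥ i with ≤-total (D i) (½ * r)
      ... | inj₁ D≤½r rewrite p≤q⇒p⊓q≡p D≤½r =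
        ≤-by (diff≥0 (≤-trans (*-monoˡ-≤-nonNeg r {{nonNegative 0≤r}} (x≤y i))
                       (≤-trans (≤-reflexive (ry≡Ax+κ i)) (+-monoˡ-≤ κ Ax≤D+E))) ⊕ 0≤D i)
          (solve 4 (λ D X E κ → D :+ D :- (X :- E :- κ) := (D :+ E :+ κ :- X) :+ D)
            refl (D i) (r * x i) (E i) κ)
        where
        Ax≤D+E : A x i ≤ D i + E i
        Ax≤D+E = ≤-trans
          (A-mono i λ j → ≤-trans (x≤1 j)
            (≤-reflexive (solve 1 (λ p → con 1ℚ := p :+ (con 1ℚ :- p)) refl (N j))))
          (≤-reflexive (A-+ N W i))
      ... | inj₂ ½r≤D rewrite p≥q⇒p⊓q≡q ½r≤D =
        ≤-by (0≤r ⊗ diff≥0 (x≤1 i) ⊕ 0≤E i ⊕ 0≤κ)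
          (solve 4 (λ r x E κ → con ½ :* r :+ con ½ :* r :- (r :* x :- E :- κ) := r :* (con 1ℚ :- x) :+ E :+ κ)
            refl r (x i) (E i) κ)

      X : ℚ
      X = ∑[ i < n ] (W i * x i)

      -- Sum `2c≥` over W: a large x-weight of W forces a large s-weight.
      2C≥ : r * X - R - ν * κ ≤ C + C
      2C≥ = begin
        r * X - R - ν * κ
          ≡⟨ cong₂ (λ p q → p - R - q) (*-distribˡ-sum r (λ i → W i * x i)) (*-distribʳ-sum κ (λ (i : Fin n) → 1ℚ)) ⟩
        ∑[ i < n ] (r * (W i * x i)) - R - ∑[ i < n ] (1ℚ * κ)
          ≡⟨ cong (_- ∑[ i < n ] (1ℚ * κ)) (sum-minus (λ i → r * (W i * x i)) (λ i → W i * E i)) ⟨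
        ∑[ i < n ] (r * (W i * x i) - W i * E i) - ∑[ i < n ] (1ℚ * κ)
          ≡⟨ sum-minus (λ i → r * (W i * x i) - W i * E i) (λ _ → 1ℚ * κ) ⟨
        ∑[ i < n ] (r * (W i * x i) - W i * E i - 1ℚ * κ)
          ≤⟨ sum-mono (λ i → ≤-by (0≤W i ⊗ diff≥0 (2c≥ i) ⊕ diff≥0 (W≤1 i) ⊗ 0≤κ)
               (solve 6 (λ r W x E κ c →
                 W :* c :+ W :* c :- (r :* (W :* x) :- W :* E :- con 1ℚ :* κ) :=
                 W :* (c :+ c :- (r :* x :- E :- κ)) :+ (con 1ℚ :- W) :* κ)
                 refl r (W i) (x i) (E i) κ (c i))) ⟩
        ∑[ i < n ] (s i + s i)
          ≡⟨ ∑-distrib-+ s s ⟩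
        C + C ∎
        where open ≤-Reasoning

      module _ (1≤b : 1ℚ ≤ b) (9b≤r : (ℤ.+ 9 / 1) * b ≤ r) where

        -- The ends share at most b neighbours, so K v + K w ≥ C - br/2 by `As≤`. As x v + x w > 1,
        -- the set W has x-weight at least r - 3b - 2κ, and `2C≥` turns this into a lower bound for
        -- C.
        codegree-edge : ∀ v w → N v ≡ 1ℚ → N w ≡ 1ℚ → a v w ≡ 1ℚ → 1ℚ < x v + x w → b * r ≤ K v + K w
        codegree-edge v w Nv Nw avw 1<xv+xw = ≤-by
          -- The doubled inequality in units of br: `9b≤r` supplies 9 from r²; `As≤` takes 1, the
          -- bound on X takes 3, R takes 1, the errors take 1 through e r ≤ r ≤ br, and the target
          -- takes 2. The last summand, rb, is what remains.
          (0≤½ ⊗ (diff≥0 As≤ ⊕ diff≥0 As≤ ⊕ diff≥0 2C≥ ⊕ 0≤r ⊗ diff≥0 r≤ ⊕ diff≥0 R≤br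
                   ⊕ <⇒≤ (diff>0 κ-small) ⊕ diff≥0 e≤1 ⊗ 0≤r
                   ⊕ 0≤r ⊗ diff≥0 9b≤r ⊕ 0≤r ⊗ diff≥0 1≤b ⊕ 0≤r ⊗ <⇒≤ 0<b))
          (solve 10 (λ b r C p q X R ν κ e →
            (C :- p) :+ (C :- q) :- b :* r :=
            con ½ :*
              ((C :+ con ½ :* r :* b :- (p :+ q)) :+ (C :+ con ½ :* r :* b :- (p :+ q))
               :+ (C :+ C :- (r :* X :- R :- ν :* κ))
               :+ r :* (X :+ b :+ b :+ b :+ (κ :+ κ) :- r)
               :+ (b :* r :- R)
               :+ (e :* r :- (ν :+ (r :+ r)) :* κ)
               :+ (con 1ℚ :- e) :* r
               :+ r :* (r :- con (ℤ.+ 9 / 1) :* b)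
               :+ r :* (b :- con 1ℚ)
               :+ r :* b))
            refl b r C (A s v) (A s w) X R ν κ e)
          where
          open ≤-Reasoning
          0≤a : ∀ i j → 0ℚ ≤ a i j
          0≤a i j = 01⇒0≤ (a-01 i j)
          0≤1-a : ∀ i j → 0ℚ ≤ 1ℚ - a i j
          0≤1-a i j = diff≥0 (01⇒≤1 (a-01 i j))

          s≤½r : ∀ i → s i ≤ ½ * r
          s≤½r i = ≤-by (diff≥0 (c≤½r i) ⊕ diff≥0 (W≤1 i) ⊗ 0≤c i)
            (solve 3 (λ h W c → h :- W :* c := (h :- c) :+ (con 1ℚ :- W) :* c) refl (½ * r) (W i) (c i))

          -- Only common neighbours are counted twice, and the truncation of c makes each second
          -- count cost at most r/2.
          As≤ : A s v + A s w ≤ C + ½ * r * b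
          As≤ = begin
            A s v + A s w
              ≡⟨ ∑-distrib-+ (λ j → s j * a v j) (λ j → s j * a w j) ⟨
            ∑[ j < n ] (s j * a v j + s j * a w j)
              ≤⟨ sum-mono (λ j → ≤-by
                   (0≤s j ⊗ (0≤1-a v j ⊗ 0≤1-a w j) ⊕ diff≥0 (s≤½r j) ⊗ (0≤a v j ⊗ 0≤a w j))
                   (solve 4 (λ s h p q →
                     s :+ h :* (p :* q) :- (s :* p :+ s :* q) :=
                     s :* ((con 1ℚ :- p) :* (con 1ℚ :- q)) :+ (h :- s) :* (p :* q))
                     refl (s j) (½ * r) (a v j) (a w j))) ⟩
            ∑[ j < n ] (s j + ½ * r * (a v j * a w j))
              ≡⟨ ∑-distrib-+ s (λ j → ½ * r * (a v j * a w j)) ⟩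
            C + ∑[ j < n ] (½ * r * (a v j * a w j))
              ≡⟨ cong (C +_) (sum-scale (½ * r) (λ j → a v j * a w j)) ⟩
            C + ½ * r * ∑[ j < n ] (a v j * a w j)
              ≤⟨ +-monoʳ-≤ C (*-monoˡ-≤-nonNeg (½ * r) {{nonNegative (0≤½ ⊗ 0≤r)}} (codegree≤b v w avw)) ⟩
            C + ½ * r * b ∎

          -- Neighbours in W counted once give at most X, second counts fall on common neighbours
          -- and cost b, and the neighbours in N cost D v + D w ≤ 2b.
          Ax+Ax≤ : A x v + A x w ≤ X + b + b + b
          Ax+Ax≤ = begin
            A x v + A x w
              ≡⟨ ∑-distrib-+ (λ j → x j * a v j) (λ j → x j * a w j) ⟨
            ∑[ j < n ] (x j * a v j + x j * a w j)
              ≤⟨ sum-mono (λ j → ≤-by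
                   ((0≤W j ⊗ 0≤x j) ⊗ (0≤1-a v j ⊗ 0≤1-a w j)
                    ⊕ (0≤a v j ⊗ 0≤a w j) ⊗ (0≤N j ⊕ 0≤W j ⊗ diff≥0 (x≤1 j))
                    ⊕ 0≤N j ⊗ (0≤a v j ⊕ 0≤a w j) ⊗ diff≥0 (x≤1 j))
                   (solve 4 (λ N x p q →
                     (con 1ℚ :- N) :* x :+ p :* q :+ N :* p :+ N :* q :- (x :* p :+ x :* q) :=
                     ((con 1ℚ :- N) :* x) :* ((con 1ℚ :- p) :* (con 1ℚ :- q))
                     :+ (p :* q) :* (N :+ (con 1ℚ :- N) :* (con 1ℚ :- x))
                     :+ N :* (p :+ q) :* (con 1ℚ :- x))
                     refl (N j) (x j) (a v j) (a w j))) ⟩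
            ∑[ j < n ] (W j * x j + a v j * a w j + N j * a v j + N j * a w j)
              ≡⟨ ∑-distrib-+ (λ j → W j * x j + a v j * a w j + N j * a v j) (λ j → N j * a w j) ⟩
            ∑[ j < n ] (W j * x j + a v j * a w j + N j * a v j) + D w
              ≡⟨ cong (_+ D w) (∑-distrib-+ (λ j → W j * x j + a v j * a w j) (λ j → N j * a v j)) ⟩
            ∑[ j < n ] (W j * x j + a v j * a w j) + D v + D w
              ≡⟨ cong (λ t → t + D v + D w) (∑-distrib-+ (λ j → W j * x j) (λ j → a v j * a w j)) ⟩
            X + ∑[ j < n ] (a v j * a w j) + D v + D w
              ≤⟨ +-mono-≤ (+-mono-≤ (+-monoʳ-≤ X (codegree≤b v w avw)) (codegree≤b u v Nv)) (codegree≤b u w Nw) ⟩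
            X + b + b + b ∎

          -- Add the equations for y at v and w, using x ≤ y and x v + x w > 1.
          r≤ : r ≤ X + b + b + b + (κ + κ)
          r≤ = ≤-by
            (0≤r ⊗ <⇒≤ (diff>0 1<xv+xw) ⊕ 0≤r ⊗ diff≥0 (x≤y v) ⊕ 0≤r ⊗ diff≥0 (x≤y w) ⊕ diff≥0 Ax+Ax≤)
            (sym (trans
              (solve 6 (λ r xv xw yv yw T →
                 r :* (xv :+ xw :- con 1ℚ) :+ r :* (yv :- xv) :+ r :* (yw :- xw) :+ T :=
                 r :* yv :+ r :* yw :- r :+ T)
                 refl r (x v) (x w) (y v) (y w) _)
              (trans
                (cong₂ (λ p q → p + q - r + (X + b + b + b - (A x v + A x w))) (ry≡Ax+κ v) (ry≡Ax+κ w))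
                (solve 6 (λ p q r X b κ →
                  p :+ κ :+ (q :+ κ) :- r :+ (X :+ b :+ b :+ b :- (p :+ q)) := X :+ b :+ b :+ b :+ (κ :+ κ) :- r)
                  refl (A x v) (A x w) r X b κ))))

        -- Along an edge vw inside N, F v + F w is the charge x v K v + x w K w less br times the
        -- excess x v + x w - 1; each end carries half of the 1.
        F : Vector ℚ n
        F i = x i * K i - b * r * (x i - ½)

        -- If x v + x w > 1, then x v ≥ x v + x w - 1 and likewise for w, so that
        -- x v * K v + x w * K w ≥ (x v + x w - 1) * (K v + K w).
        0≤edge : ∀ v w → 0ℚ ≤ N v * (N w * a v w * (F v + F w))
        0≤edge v w = guard-nonNeg (a-01 u v) λ Nv →
          subst (0ℚ ≤_) (sym (*-assoc (N w) (a v w) (F v + F w)))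
            (guard-nonNeg (a-01 u w) λ Nw → guard-nonNeg (a-01 v w) λ avw → positive-part Nv Nw avw)
          where
          positive-part : N v ≡ 1ℚ → N w ≡ 1ℚ → a v w ≡ 1ℚ → 0ℚ ≤ F v + F w
          positive-part Nv Nw avw with x v + x w ≤? 1ℚ
          ... | yes ≤1 = subst (0ℚ ≤_)
            (solve 6 (λ b r p q k l →
              p :* k :+ q :* l :+ b :* r :* (con 1ℚ :- (p :+ q)) :=
              (p :* k :- b :* r :* (p :- con ½)) :+ (q :* l :- b :* r :* (q :- con ½)))
              refl b r (x v) (x w) (K v) (K w))
            (0≤x v ⊗ 0≤K v ⊕ 0≤x w ⊗ 0≤K w ⊕ <⇒≤ 0<b ⊗ 0≤r ⊗ diff≥0 ≤1)
          ... | no ≰1 = subst (0ℚ ≤_)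
            (solve 6 (λ b r p q k l →
              (p :+ q :- con 1ℚ) :* (k :+ l :- b :* r) :+ (con 1ℚ :- q) :* k :+ (con 1ℚ :- p) :* l :=
              (p :* k :- b :* r :* (p :- con ½)) :+ (q :* l :- b :* r :* (q :- con ½)))
              refl b r (x v) (x w) (K v) (K w))
            (<⇒≤ (diff>0 (≰⇒> ≰1)) ⊗ diff≥0 (codegree-edge v w Nv Nw avw (≰⇒> ≰1))
              ⊕ diff≥0 (x≤1 w) ⊗ 0≤K v ⊕ diff≥0 (x≤1 v) ⊗ 0≤K w)

        Z : ℚ
        Z = ∑[ i < n ] (N i * F i * D i)

        -- The left side runs over ordered adjacent pairs in N, where a vertex i of N comes first D
        -- i times and second D i times.
        2Z≡ : ∑[ v < n ] ∑[ w < n ] (N v * (N w * a v w * (F v + F w))) ≡ Z + Z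
        2Z≡ = begin
          ∑[ v < n ] ∑[ w < n ] (N v * (N w * a v w * (F v + F w)))
            ≡⟨ sum-cong-≗ (λ v → begin
              ∑[ w < n ] (N v * (N w * a v w * (F v + F w)))
                ≡⟨ sum-cong-≗ (λ w → solve 5 (λ Nv Nw a Fv Fw →
                     Nv :* (Nw :* a :* (Fv :+ Fw)) := Nv :* Fv :* (Nw :* a) :+ Nv :* (Nw :* Fw :* a))
                     refl (N v) (N w) (a v w) (F v) (F w)) ⟩
              ∑[ w < n ] (N v * F v * (N w * a v w) + N v * (N w * F w * a v w))
                ≡⟨ ∑-distrib-+ (λ w → N v * F v * (N w * a v w)) (λ w → N v * (N w * F w * a v w)) ⟩
              ∑[ w < n ] (N v * F v * (N w * a v w)) + ∑[ w < n ] (N v * (N w * F w * a v w))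
                ≡⟨ cong₂ _+_ (sum-scale (N v * F v) (λ w → N w * a v w))
                             (sum-scale (N v) (λ w → N w * F w * a v w)) ⟩
              N v * F v * D v + N v * A (λ w → N w * F w) v ∎) ⟩
          ∑[ v < n ] (N v * F v * D v + N v * A (λ w → N w * F w) v)
            ≡⟨ ∑-distrib-+ (λ v → N v * F v * D v) (λ v → N v * A (λ w → N w * F w) v) ⟩
          Z + ∑[ v < n ] (N v * A (λ w → N w * F w) v)
            ≡⟨ cong (Z +_) (A-selfAdjoint N (λ w → N w * F w)) ⟩
          Z + Z ∎
          where open ≡-Reasoning

        0≤Z+Z : 0ℚ ≤ Z + Z
        0≤Z+Z = subst (0ℚ ≤_) 2Z≡ (sum-nonNeg λ v → sum-nonNeg λ w → 0≤edge v w)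

        -- The charges x K are nonnegative and each is counted D ≤ b times on N; the excess part is
        -- kept exactly.
        Z≤ : Z ≤ b * ∑[ i < n ] (N i * x i * K i) - b * r * (α - ½ * P)
        Z≤ = begin
          Z
            ≤⟨ sum-mono (λ i → ≤-by (0≤x i ⊗ 0≤K i ⊗ diff≥0 (ND≤Nb i))
                 (solve 6 (λ N D x k b r →
                   b :* (N :* x :* k) :- b :* r :* (N :* (D :* x) :- con ½ :* (N :* D))
                     :- N :* (x :* k :- b :* r :* (x :- con ½)) :* D :=
                   x :* k :* (N :* b :- N :* D))
                   refl (N i) (D i) (x i) (K i) b r)) ⟩
          ∑[ i < n ] (b * (N i * x i * K i) - b * r * (N i * (D i * x i) - ½ * (N i * D i)))
            ≡⟨ sum-minus (λ i → b * (N i * x i * K i)) (λ i → b * r * (N i * (D i * x i) - ½ * (N i * D i))) ⟩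
          ∑[ i < n ] (b * (N i * x i * K i)) - ∑[ i < n ] (b * r * (N i * (D i * x i) - ½ * (N i * D i)))
            ≡⟨ cong₂ _-_ (sum-scale b (λ i → N i * x i * K i))
                 (trans (sum-scale (b * r) (λ i → N i * (D i * x i) - ½ * (N i * D i)))
                   (cong (b * r *_) (trans (sum-minus (λ i → N i * (D i * x i)) (λ i → ½ * (N i * D i)))
                     (cong (λ t → α - t) (sum-scale ½ (λ i → N i * D i)))))) ⟩
          b * ∑[ i < n ] (N i * x i * K i) - b * r * (α - ½ * P) ∎
          where open ≤-Reasoning

        -- Doubling `Z≤` and inserting `NxK≤` gives 0 ≤ 2Z ≤ br (P + R + 2G - 2α), which is negative
        -- by `excess`.
        impossible : ⊥
        impossible = <-irrefl refl (≤-<-trans 0≤Z+Z (<-by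
          ((0<b ⊠ 0<r ⊠ diff>0 excess) ⊞ (diff≥0 Z≤ ⊕ diff≥0 Z≤) ⊞ (0≤b ⊗ diff≥0 NxK≤ ⊕ 0≤b ⊗ diff≥0 NxK≤))
          (solve 8 (λ Z b r T α P G R →
            con 0ℚ :- (Z :+ Z) :=
            b :* r :* (α :+ α :- (P :+ R :+ (G :+ G)))
              :+ ((b :* T :- b :* r :* (α :- con ½ :* P) :- Z) :+ (b :* T :- b :* r :* (α :- con ½ :* P) :- Z))
              :+ (b :* (r :* G :+ con ½ :* r :* R :- T) :+ b :* (r :* G :+ con ½ :* r :* R :- T)))
            refl Z b r (∑[ i < n ] (N i * x i * K i)) α P G R)))
          where
          0≤b : 0ℚ ≤ b
          0≤b = <⇒≤ 0<b

    -- Scaling: divide Y = A X + η by its maximum T and put x = r X / T. Then r y = A x + κ holds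
    -- exactly with κ = r η / T, and x ≤ y is the hypothesis r X ≤ A X + η.
    no-almost-eigenvector :
      ∀ (X : Vector ℚ n) k r η δ e →
      (∀ i → 0ℚ ≤ X i) → (∀ i → r * X i ≤ A X i + η) → δ ≤ X k →
      0ℚ < r → 0ℚ ≤ η → 0ℚ < δ → 0ℚ ≤ e → e ≤ 1ℚ →
      m + e * r ≤ r * r → (ℤ.+ 9 / 1) * b ≤ r →
      (∑[ i < n ] 1ℚ + (r + r)) * η < e * (r * δ) → b ≡ 0ℚ ⊎ 1ℚ ≤ b → ⊥
    no-almost-eigenvector X k r η δ e 0≤X rX≤Y δ≤Xk 0<r 0≤η 0<δ 0≤e e≤1 m+er≤r² 9b≤r η-small = cases
      where
      Y : Vector ℚ n
      Y i = A X i + η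
      u = proj₁ (argmax k Y)
      T = Y u
      0≤r = <⇒≤ 0<r

      -- The bound δ at the vertex k keeps T away from 0, which is what makes κ small.
      rδ≤T : r * δ ≤ T
      rδ≤T = ≤-trans (*-monoˡ-≤-nonNeg r {{nonNegative 0≤r}} δ≤Xk)
               (≤-trans (rX≤Y k) (proj₂ (argmax k Y) k))

      0<T : 0ℚ < T
      0<T = <-≤-trans (0<r ⊠ 0<δ) rδ≤T

      instance
        T-pos = positive 0<T
        T≢0 = pos⇒nonZero T

      t = 1/ T

      0<t : 0ℚ < t
      0<t = positive⁻¹ t {{1/pos⇒pos T}}

      0≤t = <⇒≤ 0<t

      x y : Vector ℚ n
      x i = (r * t) * X i
      y i = Y i * t
      κ = r * t * η

      ry≡ : ∀ i → r * y i ≡ A x i + κ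
      ry≡ i = begin
        r * ((A X i + η) * t)
          ≡⟨ solve 4 (λ r A η t → r :* ((A :+ η) :* t) := r :* t :* A :+ r :* t :* η) refl r (A X i) η t ⟩
        r * t * A X i + κ
          ≡⟨ cong (_+ κ) (trans (*-distribˡ-sum (r * t) (λ j → X j * a i j))
               (sum-cong-≗ λ j → sym (*-assoc (r * t) (X j) (a i j)))) ⟩
        A x i + κ ∎
        where open ≡-Reasoning

      κ-small : (∑[ i < n ] 1ℚ + (r + r)) * κ < e * r
      κ-small = <-by
        (0<r ⊠ (0<t ⊠ diff>0 η-small) ⊞ 0≤r ⊗ (0≤t ⊗ (0≤e ⊗ diff≥0 rδ≤T)))
        (sym (trans
          (solve 7 (λ r t e δ η ν T →
            r :* (t :* (e :* (r :* δ) :- (ν :+ (r :+ r)) :* η)) :+ r :* (t :* (e :* (T :- r :* δ))) :=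
            e :* r :* (T :* t) :- (ν :+ (r :+ r)) :* (r :* t :* η))
            refl r t e δ η (∑[ i < n ] 1ℚ) T)
          (trans (cong (λ p → e * r * p - (∑[ i < n ] 1ℚ + (r + r)) * κ) (*-inverseʳ T))
                 (cong (_- (∑[ i < n ] 1ℚ + (r + r)) * κ) (*-identityʳ (e * r))))))

      0≤x : ∀ i → 0ℚ ≤ x i
      0≤x i = 0≤r ⊗ 0≤t ⊗ 0≤X i

      x≤y : ∀ i → x i ≤ y i
      x≤y i = ≤-by (0≤t ⊗ diff≥0 (rX≤Y i))
        (solve 4 (λ r t X Y → Y :* t :- r :* t :* X := t :* (Y :- r :* X)) refl r t (X i) (Y i))

      y≤1 : ∀ i → y i ≤ 1ℚ
      y≤1 i = ≤-trans (*-monoʳ-≤-nonNeg t {{nonNegative 0≤t}} (proj₂ (argmax k Y) i))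
                      (≤-reflexive (*-inverseʳ T))

      cases : b ≡ 0ℚ ⊎ 1ℚ ≤ b → ⊥
      -- `codegree-edge` absorbs r into br and so asks for b ≥ 1; the value 0 is excluded by `0<b`.
      cases (inj₁ b≡0) = <-irrefl (sym b≡0)
        (AlmostEigenvector.0<b u x y r κ e 0≤x x≤y y≤1 (*-inverseʳ T) ry≡ 0<r (0≤r ⊗ 0≤t ⊗ 0≤η)
          e≤1 m+er≤r² κ-small)
      cases (inj₂ 1≤b) =
        AlmostEigenvector.impossible u x y r κ e 0≤x x≤y y≤1 (*-inverseʳ T) ry≡ 0<r (0≤r ⊗ 0≤t ⊗ 0≤η)
          e≤1 m+er≤r² κ-small 1≤b 9b≤r

  -- Counting edges and common neighbours

  -- The recursion lets counts be compared with sums by induction; `ι≡/1` links it to the fractions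
  -- that embed the naturals in the reals.
  ι : ℕ → ℚ
  ι zero    = 0ℚ
  ι (suc n) = 1ℚ + ι n

  ι≡/1 : ∀ n → ι n ≡ ℤ.+ n / 1
  ι≡/1 zero    = refl
  ι≡/1 (suc n) = trans (cong (λ t → 1ℚ + t) (ι≡/1 n)) (toℚᵘ-injective (begin
    toℚᵘ (1ℚ + ℤ.+ n / 1)                ≈⟨ toℚᵘ-homo-+ 1ℚ (ℤ.+ n / 1) ⟩
    ℚᵘ.1ℚᵘ ℚᵘ.+ toℚᵘ (ℤ.+ n / 1)         ≈⟨ ℚᵘ.+-congʳ ℚᵘ.1ℚᵘ (toℚᵘ-fromℚᵘ (ℚᵘ.mkℚᵘ (ℤ.+ n) 0)) ⟩
    ℚᵘ.1ℚᵘ ℚᵘ.+ ℚᵘ.mkℚᵘ (ℤ.+ n) 0        ≈⟨ ℚᵘ.*≡* (cong (λ k → (ℤ.1ℤ ℤ.+ k) ℤ.* ℤ.1ℤ) (ℤ.*-identityʳ (ℤ.+ n))) ⟩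
    ℚᵘ.mkℚᵘ (ℤ.+ suc n) 0                ≈⟨ toℚᵘ-fromℚᵘ (ℚᵘ.mkℚᵘ (ℤ.+ suc n) 0) ⟨
    toℚᵘ (ℤ.+ suc n / 1)                 ∎))
    where open import Relation.Binary.Reasoning.Setoid ℚᵘ.≃-setoid

  ι-+ : ∀ m n → ι (m ℕ.+ n) ≡ ι m + ι n
  ι-+ zero    n = sym (+-identityˡ (ι n))
  ι-+ (suc m) n rewrite ι-+ m n = sym (+-assoc 1ℚ (ι m) (ι n))

  ι-* : ∀ m n → ι (m ℕ.* n) ≡ ι m * ι n
  ι-* zero    n = sym (*-zeroˡ (ι n))
  ι-* (suc m) n rewrite ι-+ n (m ℕ.* n) | ι-* m n =
    solve 2 (λ m n → n :+ m :* n := (con 1ℚ :+ m) :* n) refl (ι m) (ι n)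

  0≤ι : ∀ n → 0ℚ ≤ ι n
  0≤ι zero    = ≤-refl
  0≤ι (suc n) = 0≤1 ⊕ 0≤ι n

  ι-mono-≤ : ∀ {m n} → m ℕ.≤ n → ι m ≤ ι n
  ι-mono-≤ {m} {n} m≤n = ≤-by (0≤ι (n ℕ.∸ m)) (begin
    ι n - ι m                      ≡⟨ cong (λ k → ι k - ι m) (ℕ.m+[n∸m]≡n m≤n) ⟨
    ι (m ℕ.+ (n ℕ.∸ m)) - ι m      ≡⟨ cong (_- ι m) (ι-+ m (n ℕ.∸ m)) ⟩
    ι m + ι (n ℕ.∸ m) - ι m        ≡⟨ solve 2 (λ p q → p :+ q :- p := q) refl (ι m) (ι (n ℕ.∸ m)) ⟩
    ι (n ℕ.∸ m)                    ∎)
    where open ≡-Reasoning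

  -- Indicator sums and lengths of filtered lists

  𝟙 : Bool → ℚ
  𝟙 p = if p then 1ℚ else 0ℚ

  𝟙-∧ : ∀ p q → 𝟙 (p ∧ q) ≡ 𝟙 p * 𝟙 q
  𝟙-∧ true  q = sym (*-identityˡ (𝟙 q))
  𝟙-∧ false q = sym (*-zeroˡ (𝟙 q))

  𝟙-01 : ∀ p → 𝟙 p ≡ 0ℚ ⊎ 𝟙 p ≡ 1ℚ
  𝟙-01 true  = inj₂ refl
  𝟙-01 false = inj₁ refl

  module _ {ℓ} {X : Set ℓ} where

    total : (X → ℚ) → List X → ℚ
    total f []       = 0ℚ
    total f (x ∷ xs) = f x + total f xs

    total-++ : ∀ f xs ys → total f (xs ++ ys) ≡ total f xs + total f ys
    total-++ f []       ys = sym (+-identityˡ (total f ys))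
    total-++ f (x ∷ xs) ys = trans
      (cong (λ t → f x + t) (total-++ f xs ys))
      (sym (+-assoc (f x) (total f xs) (total f ys)))

    total-tabulate : ∀ {n} f (g : Fin n → X) → total f (tabulate g) ≡ ∑[ i < n ] f (g i)
    total-tabulate {zero}  f g = refl
    total-tabulate {suc n} f g = cong (λ t → f (g zero) + t) (total-tabulate f (g ∘ suc))

    ι-length-filter : ∀ {P : Pred X ℓ} (P? : Decidable P) xs →
                      ι (length (filter P? xs)) ≡ total (λ x → 𝟙 (does (P? x))) xs
    ι-length-filter P? []       = refl
    ι-length-filter P? (x ∷ xs) with does (P? x)
    ... | true  = cong (λ t → 1ℚ + t) (ι-length-filter P? xs)
    ... | false = trans (ι-length-filter P? xs) (sym (+-identityˡ _))

  total-map : ∀ {X Y : Set} (f : Y → ℚ) (g : X → Y) xs → total f (map g xs) ≡ total (f ∘ g) xs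
  total-map f g []       = refl
  total-map f g (x ∷ xs) = cong (λ t → f (g x) + t) (total-map f g xs)

  total-cartesianProduct : ∀ {X Y : Set} (f : X × Y → ℚ) xs ys →
    total f (cartesianProduct xs ys) ≡ total (λ x → total (λ y → f (x , y)) ys) xs
  total-cartesianProduct f []       ys = refl
  total-cartesianProduct f (x ∷ xs) ys = trans
    (total-++ f (map (x ,_) ys) (cartesianProduct xs ys))
    (cong₂ _+_ (total-map f (x ,_) ys) (total-cartesianProduct f xs ys))

  lookup-injective : ∀ {X : Set} {xs : List X} → Unique xs → Injective _≡_ _≡_ (lookup xs)
  lookup-injective (_   ∷ _)  {zero}  {zero}  _  = refl
  lookup-injective (x∉ ∷ _)   {zero}  {suc j} eq = ⊥-elim (All.lookup x∉ (∈.∈-lookup j) eq)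
  lookup-injective (x∉ ∷ _)   {suc i} {zero}  eq = ⊥-elim (All.lookup x∉ (∈.∈-lookup i) (sym eq))
  lookup-injective (_  ∷ xs!) {suc i} {suc j} eq = cong suc (lookup-injective xs! eq)

  module _ {n : ℕ} (G : Graph n) where
    open Graph G

    adj : Fin n → Fin n → ℚ
    adj i j = 𝟙 (does (adj? i j))

    adj-01 : ∀ i j → adj i j ≡ 0ℚ ⊎ adj i j ≡ 1ℚ
    adj-01 i j = 𝟙-01 (does (adj? i j))

    adj≡1⇒Adj : ∀ i j → adj i j ≡ 1ℚ → Adj i j
    adj≡1⇒Adj i j eq with adj? i j
    ... | yes ij = ij

    adj-sym : ∀ i j → adj i j ≡ adj j i
    adj-sym i j with adj? i j | adj? j i
    ... | yes ij | yes ji = refl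
    ... | yes ij | no ¬ji = ⊥-elim (¬ji (symm ij))
    ... | no ¬ij | yes ji = ⊥-elim (¬ij (symm ji))
    ... | no ¬ij | no ¬ji = refl

    private
      up : Fin n → Fin n → ℚ
      up i j = 𝟙 (does (i F.<? j ×-dec adj? i j))

      -- `edges` lists an edge only in increasing order of its ends, so the adjacency matrix is
      -- split into its two triangles; the diagonal vanishes by irreflexivity.
      adj≡up+up : ∀ i j → adj i j ≡ up i j + up j i
      adj≡up+up i j with F.<-cmp i j
      ... | tri< i<j _ j≮i rewrite dec-true (i F.<? j) i<j | dec-false (j F.<? i) j≮i = sym (+-identityʳ (adj i j))
      ... | tri> i≮j _ j<i rewrite dec-false (i F.<? j) i≮j | dec-true (j F.<? i) j<i =
        trans (adj-sym i j) (sym (+-identityˡ (adj j i)))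
      ... | tri≈ i≮j refl _ rewrite dec-false (i F.<? i) i≮j | dec-false (adj? i i) (irrefl refl) = refl

    handshake : ∑[ i < n ] ∑[ j < n ] adj i j ≡ ι (#edges G) + ι (#edges G)
    handshake = begin
      ∑[ i < n ] ∑[ j < n ] adj i j
        ≡⟨ sum-cong-≗ (λ i → trans (sum-cong-≗ (adj≡up+up i)) (∑-distrib-+ (up i) (λ j → up j i))) ⟩
      ∑[ i < n ] (∑[ j < n ] up i j + ∑[ j < n ] up j i)
        ≡⟨ ∑-distrib-+ (λ i → ∑[ j < n ] up i j) (λ i → ∑[ j < n ] up j i) ⟩
      ∑[ i < n ] ∑[ j < n ] up i j + ∑[ i < n ] ∑[ j < n ] up j i
        ≡⟨ cong₂ _+_ count (trans (sym (∑-comm up)) count) ⟩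
      ι (#edges G) + ι (#edges G) ∎
      where
      open ≡-Reasoning
      count : ∑[ i < n ] ∑[ j < n ] up i j ≡ ι (#edges G)
      count = sym (begin
        ι (#edges G)
          ≡⟨ ι-length-filter (λ (i , j) → i F.<? j ×-dec adj? i j) (cartesianProduct (allFin n) (allFin n)) ⟩
        total (λ (i , j) → up i j) (cartesianProduct (allFin n) (allFin n))
          ≡⟨ total-cartesianProduct (λ (i , j) → up i j) (allFin n) (allFin n) ⟩
        total (λ i → total (up i) (allFin n)) (allFin n)
          ≡⟨ total-tabulate (λ i → total (up i) (allFin n)) id ⟩
        ∑[ i < n ] total (up i) (allFin n)
          ≡⟨ sum-cong-≗ (λ i → total-tabulate (up i) id) ⟩
        ∑[ i < n ] ∑[ j < n ] up i j ∎)

    -- Books formed by the common neighbours of an edge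

    module _ {i j : Fin n} (ij : Adj i j) where

      private
        common? : Decidable (λ k → Adj i k × Adj j k)
        common? k = adj? i k ×-dec adj? j k

      commonNeighbours : List (Fin n)
      commonNeighbours = filter common? (allFin n)

      private
        adjacent : ∀ t → Adj i (lookup commonNeighbours t) × Adj j (lookup commonNeighbours t)
        adjacent t = All.lookup (All.all-filter common? (allFin n)) (∈.∈-lookup t)

        page : Fin (2 ℕ.+ length commonNeighbours) → Fin n
        page zero          = i
        page (suc zero)    = j
        page (suc (suc t)) = lookup commonNeighbours t

        adjacent-to-spine : ∀ {s t} → s ≢ t → F.toℕ s ℕ.< 2 → Adj (page s) (page t)
        adjacent-to-spine {zero}     {zero}        s≢t _ = ⊥-elim (s≢t refl)
        adjacent-to-spine {zero}     {suc zero}    _   _ = ij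
        adjacent-to-spine {zero}     {suc (suc t)} _   _ = proj₁ (adjacent t)
        adjacent-to-spine {suc zero} {zero}        _   _ = symm ij
        adjacent-to-spine {suc zero} {suc zero}    s≢t _ = ⊥-elim (s≢t refl)
        adjacent-to-spine {suc zero} {suc (suc t)} _   _ = proj₂ (adjacent t)
        adjacent-to-spine {suc (suc s)} _ (ℕ.s≤s (ℕ.s≤s ()))

        -- The ends of the spine differ from every other vertex because adjacent vertices are
        -- distinct; the remaining vertices are entries of a list without repetition.
        page-injective : Injective _≡_ _≡_ page
        page-injective {zero}        {zero}        _  = refl
        page-injective {zero}        {suc t}       eq =
          ⊥-elim (irrefl eq (adjacent-to-spine {zero} {suc t} (λ ()) (ℕ.s≤s ℕ.z≤n)))
        page-injective {suc s}       {zero}        eq =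
          ⊥-elim (irrefl (sym eq) (adjacent-to-spine {zero} {suc s} (λ ()) (ℕ.s≤s ℕ.z≤n)))
        page-injective {suc zero}    {suc zero}    _  = refl
        page-injective {suc zero}    {suc (suc t)} eq = ⊥-elim (irrefl eq (proj₂ (adjacent t)))
        page-injective {suc (suc s)} {suc zero}    eq = ⊥-elim (irrefl (sym eq) (proj₂ (adjacent s)))
        page-injective {suc (suc s)} {suc (suc t)} eq = cong (λ t → Fin.suc (Fin.suc t))
          (lookup-injective (Unique.filter⁺ common? (Unique.allFin⁺ n)) eq)

      book-commonNeighbours : book (length commonNeighbours) ⊑ G
      book-commonNeighbours = page , page-injective , λ
        { (s≢t , inj₁ s<2) → adjacent-to-spine s≢t s<2
        ; (s≢t , inj₂ t<2) → symm (adjacent-to-spine (s≢t ∘ sym) t<2) }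

    codegree≤booksize : ∀ {b} → IsBooksize G b → ∀ i j → adj i j ≡ 1ℚ → ∑[ k < n ] (adj i k * adj j k) ≤ ι b
    codegree≤booksize {b} (_ , maximal) i j eq = begin
      ∑[ k < n ] (adj i k * adj j k)
        ≡⟨ sum-cong-≗ (λ k → 𝟙-∧ (does (adj? i k)) (does (adj? j k))) ⟨
      ∑[ k < n ] 𝟙 (does (adj? i k ×-dec adj? j k))
        ≡⟨ total-tabulate (λ k → 𝟙 (does (adj? i k ×-dec adj? j k))) id ⟨
      total (λ k → 𝟙 (does (adj? i k ×-dec adj? j k))) (allFin n)
        ≡⟨ ι-length-filter (λ k → adj? i k ×-dec adj? j k) (allFin n) ⟨
      ι (length common)
        ≤⟨ ι-mono-≤ bounded ⟩
      ι b ∎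
      where
      open ≤-Reasoning
      ij = adj≡1⇒Adj i j eq
      common = commonNeighbours ij
      bounded : length common ℕ.≤ b
      bounded with length common in eq′
      -- The maximality in `IsBooksize` speaks only of books with at least one page.
      ... | zero  = ℕ.z≤n
      ... | suc k = maximal (suc k) (ℕ.s≤s ℕ.z≤n) (subst (λ l → book l ⊑ G) eq′ (book-commonNeighbours ij))

  -- From Cauchy reals to rational approximations

  square-cancel-< : ∀ {p q} → 0ℚ ≤ q → p * p < q * q → p < q
  square-cancel-< {p} {q} 0≤q p²<q² = ≰⇒> λ q≤p → <-irrefl refl (<-≤-trans p²<q²
    (≤-by (0≤q ⊗ diff≥0 q≤p ⊕ diff≥0 q≤p ⊗ (0≤q ⊕ diff≥0 q≤p))
      (solve 2 (λ p q → p :* p :- q :* q := q :* (p :- q) :+ (p :- q) :* (q :+ (p :- q))) refl p q)))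

  natural-bound : ∀ q → ∃[ k ] q ≤ ι k
  natural-bound q@(mkℚ (ℤ.+ p) d _) = p , subst (q ≤_) (sym (ι≡/1 p)) (toℚᵘ-cancel-≤
    (ℚᵘ.≤-respʳ-≃ (ℚᵘ.≃-sym (toℚᵘ-fromℚᵘ (ℚᵘ.mkℚᵘ (ℤ.+ p) 0)))
      (ℚᵘ.*≤* (ℤ.*-monoˡ-≤-nonNeg (ℤ.+ p) (ℤ.+≤+ (ℕ.s≤s ℕ.z≤n))))))
  natural-bound q@(mkℚ ℤ.-[1+ _ ] _ _) = 0 , <⇒≤ (negative⁻¹ q)

  archimedean : ∀ e → 0ℚ < e → ∃[ N ] ∀ k → N ℕ.≤ k → 1ℚ ≤ e * ι (suc k)
  archimedean e 0<e = N , λ k N≤k → begin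
    1ℚ            ≡⟨ *-inverseʳ e ⟨
    e * 1/ e      ≤⟨ *-monoˡ-≤-nonNeg e {{nonNegative (<⇒≤ 0<e)}}
                       (≤-trans (proj₂ (natural-bound (1/ e))) (ι-mono-≤ (ℕ.m≤n⇒m≤1+n N≤k))) ⟩
    e * ι (suc k) ∎
    where
    open ≤-Reasoning
    instance e≢0 = pos⇒nonZero e {{positive 0<e}}
    N = proj₁ (natural-bound (1/ e))

  1≤ι-suc : ∀ n → 1ℚ ≤ ι (suc n)
  1≤ι-suc n = ≤-by (0≤ι n) (solve 1 (λ p → con 1ℚ :+ p :- con 1ℚ := p) refl (ι n))

  -- Two copies of e must fit under the gap ε: one absorbs the error of the rational square root,
  -- the other yields the gain e r of r² over m.
  half-or-one : ∀ ε → 0ℚ < ε → ∃[ e ] 0ℚ < e × e + e ≤ ε × e ≤ 1ℚ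
  half-or-one ε 0<ε with ≤-total (½ * ε) 1ℚ
  ... | inj₁ ½ε≤1 = ½ * ε , positive⁻¹ ½ ⊠ 0<ε ,
    ≤-reflexive (solve 1 (λ ε → con ½ :* ε :+ con ½ :* ε := ε) refl ε) , ½ε≤1
  ... | inj₂ 1≤½ε = 1ℚ , positive⁻¹ 1ℚ ,
    ≤-trans (+-mono-≤ 1≤½ε 1≤½ε) (≤-reflexive (solve 1 (λ ε → con ½ :* ε :+ con ½ :* ε := ε) refl ε)) , ≤-refl

  quotient : ∀ p → 0ℚ < p → ∀ q → 0ℚ < q → ∃[ s ] 0ℚ < s × p * s ≡ q
  quotient p 0<p q 0<q =
    1/ p * q , positive⁻¹ (1/ p) {{1/pos⇒pos p}} ⊠ 0<q ,
    trans (sym (*-assoc p (1/ p) q)) (trans (cong (_* q) (*-inverseʳ p)) (*-identityˡ q))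
    where
    instance
      p-pos = positive 0<p
      p≢0 = pos⇒nonZero p

  eventually-all : ∀ {n} {P : Fin n → ℕ → Set} →
    (∀ i → ∃[ N ] ∀ k → N ℕ.≤ k → P i k) → ∃[ N ] ∀ k → N ℕ.≤ k → ∀ i → P i k
  eventually-all {zero}  _ = 0 , λ _ _ ()
  eventually-all {suc n} h with h zero | eventually-all (h ∘ suc)
  ... | M , hM | N , hN = M ℕ.⊔ N , λ k ≤k → λ
    { zero    → hM k (ℕ.≤-trans (ℕ.m≤m⊔n M N) ≤k)
    ; (suc i) → hN k (ℕ.≤-trans (ℕ.m≤n⊔m M N) ≤k) i }

  seq-foldr : ∀ {n} (f : Vector ℝ n) k → seq (foldr Defs._+_ 0ℝ f) k ≡ ∑[ i < n ] seq (f i) k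
  seq-foldr {zero}  f k = refl
  seq-foldr {suc n} f k = cong (λ t → seq (f zero) k + t) (seq-foldr (f ∘ suc) k)

  seq-· : ∀ {n} {M : Defs.Matrix n} {a : Fin n → Fin n → ℚ} → (∀ i j k → seq (M i j) k ≡ a i j) →
    ∀ x i k → seq ((M · x) i) k ≡ apply a (λ j → seq (x j) k) i
  seq-· {M = M} {a} M≡a x i k = trans (seq-foldr (λ j → M i j Defs.* x j) k)
    (sum-cong-≗ λ j → trans (cong (_* seq (x j) k) (M≡a i j k)) (*-comm (a i j) (seq (x j) k)))

  seq-if : ∀ p k → seq (if p then Defs.1ℝ else 0ℝ) k ≡ 𝟙 p
  seq-if true  k = refl
  seq-if false k = refl

  ∣sum∣≤ : ∀ {n} (f : Vector ℚ n) → ∣ sum f ∣ ≤ ∑[ i < n ] ∣ f i ∣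
  ∣sum∣≤ {zero}  f = ≤-refl
  ∣sum∣≤ {suc n} f = ≤-trans (∣p+q∣≤∣p∣+∣q∣ (f zero) (sum (f ∘ suc))) (+-monoʳ-≤ ∣ f zero ∣ (∣sum∣≤ (f ∘ suc)))

  -- Rational bounds for the approximate square root

  module _ (m k : ℕ) where

    private
      t = √-approx m k
      Q = ι (suc k)
      root = ⌊√ m ℕ.* (suc k ℕ.* suc k) ⌋

      0<Q : 0ℚ < Q
      0<Q = <-by (positive⁻¹ 1ℚ ⊞ 0≤ι k) (+-identityʳ Q)

      instance
        Q²-pos = positive (0<Q ⊠ 0<Q)

      tQ≡ : t * Q ≡ ι root
      tQ≡ = trans (cong (t *_) (ι≡/1 (suc k))) (trans (toℚᵘ-injective (begin
        toℚᵘ (t * (ℤ.+ suc k / 1))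
          ≈⟨ toℚᵘ-homo-* t (ℤ.+ suc k / 1) ⟩
        toℚᵘ t ℚᵘ.* toℚᵘ (ℤ.+ suc k / 1)
          ≈⟨ ℚᵘ.*-cong (toℚᵘ-fromℚᵘ (ℚᵘ.mkℚᵘ (ℤ.+ root) k)) (toℚᵘ-fromℚᵘ (ℚᵘ.mkℚᵘ (ℤ.+ suc k) 0)) ⟩
        ℚᵘ.mkℚᵘ (ℤ.+ root) k ℚᵘ.* ℚᵘ.mkℚᵘ (ℤ.+ suc k) 0
          ≈⟨ ℚᵘ.*≡* (trans (ℤ.*-assoc (ℤ.+ root) (ℤ.+ suc k) ℤ.1ℤ)
               (cong (λ d → ℤ.+ root ℤ.* d) (ℤ.pos-* (suc k) 1))) ⟩
        ℚᵘ.mkℚᵘ (ℤ.+ root) 0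
          ≈⟨ toℚᵘ-fromℚᵘ (ℚᵘ.mkℚᵘ (ℤ.+ root) 0) ⟨
        toℚᵘ (ℤ.+ root / 1) ∎)) (sym (ι≡/1 root)))
        where open import Relation.Binary.Reasoning.Setoid ℚᵘ.≃-setoid

      mQQ≡ : ι (m ℕ.* (suc k ℕ.* suc k)) ≡ ι m * (Q * Q)
      mQQ≡ = trans (ι-* m (suc k ℕ.* suc k)) (cong (ι m *_) (ι-* (suc k) (suc k)))

    √-approx-nonNeg : 0ℚ ≤ t
    √-approx-nonNeg = *-cancelʳ-≤-pos Q {{positive 0<Q}}
      (subst₂ _≤_ (sym (*-zeroˡ Q)) (sym tQ≡) (0≤ι root))

    √-approx-lower : t * t ≤ ι m
    √-approx-lower = *-cancelʳ-≤-pos (Q * Q) (begin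
      t * t * (Q * Q)        ≡⟨ solve 2 (λ t Q → t :* t :* (Q :* Q) := t :* Q :* (t :* Q)) refl t Q ⟩
      t * Q * (t * Q)        ≡⟨ cong₂ _*_ tQ≡ tQ≡ ⟩
      ι root * ι root        ≡⟨ ι-* root root ⟨
      ι (root ℕ.* root)      ≤⟨ ι-mono-≤ (⌊√⌋-lower (m ℕ.* (suc k ℕ.* suc k))) ⟩
      ι (m ℕ.* (suc k ℕ.* suc k)) ≡⟨ mQQ≡ ⟩
      ι m * (Q * Q)          ∎)
      where open ≤-Reasoning

    -- Clearing the denominator Q leaves m Q² ≤ (root + 1)², and 1 ≤ eQ replaces the 1.
    √-approx-upper : ∀ {e} → 1ℚ ≤ e * Q → ι m ≤ (t + e) * (t + e)
    √-approx-upper {e} 1≤eQ = *-cancelʳ-≤-pos (Q * Q) (begin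
      ι m * (Q * Q)                        ≡⟨ mQQ≡ ⟨
      ι (m ℕ.* (suc k ℕ.* suc k))          ≤⟨ ι-mono-≤ (ℕ.<⇒≤ (⌊√⌋-upper (m ℕ.* (suc k ℕ.* suc k)))) ⟩
      ι (suc root ℕ.* suc root)            ≡⟨ ι-* (suc root) (suc root) ⟩
      (1ℚ + ι root) * (1ℚ + ι root)        ≡⟨ cong (λ p → (1ℚ + p) * (1ℚ + p)) tQ≡ ⟨
      (1ℚ + t * Q) * (1ℚ + t * Q)          ≤⟨ ≤-by
        (diff≥0 1≤eQ ⊗ (0≤tQ ⊕ 0≤tQ ⊕ (0≤1 ⊕ 0≤1) ⊕ diff≥0 1≤eQ))
        (solve 3 (λ t e Q →
          (t :+ e) :* (t :+ e) :* (Q :* Q) :- (con 1ℚ :+ t :* Q) :* (con 1ℚ :+ t :* Q) :=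
          (e :* Q :- con 1ℚ) :* (t :* Q :+ t :* Q :+ (con 1ℚ :+ con 1ℚ) :+ (e :* Q :- con 1ℚ)))
          refl t e Q) ⟩
      (t + e) * (t + e) * (Q * Q)          ∎)
      where
      open ≤-Reasoning
      0≤tQ = √-approx-nonNeg ⊗ <⇒≤ 0<Q

  -- Approximate eigenvectors when 81 b² ≤ m

  module _ {n : ℕ} (G : Graph n) {b : ℕ} (booksize : IsBooksize G b) (81b²≤m : 9 ℕ.* b ℕ.* (9 ℕ.* b) ℕ.≤ #edges G) where

    private
      m = ι (#edges G)
      A = apply (adj G)

      ν = ∑[ i < n ] 1ℚ
      three = 1ℚ + 1ℚ + 1ℚ

      0≤ν : 0ℚ ≤ ν
      0≤ν = sum-nonNeg λ (i : Fin n) → 0≤1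

      ∣A∣≤ : ∀ f i → ∣ A f i ∣ ≤ A (λ j → ∣ f j ∣) i
      ∣A∣≤ f i = ≤-trans (∣sum∣≤ (λ j → f j * adj G i j)) (≤-reflexive (sum-cong-≗ λ j →
        trans (∣p*q∣≡∣p∣*∣q∣ (f j) (adj G i j)) (cong (∣ f j ∣ *_) (0≤p⇒∣p∣≡p (01⇒0≤ (adj-01 G i j))))))

      b≡0⊎1≤b : ∀ b → ι b ≡ 0ℚ ⊎ 1ℚ ≤ ι b
      b≡0⊎1≤b zero    = inj₁ refl
      b≡0⊎1≤b (suc b) = inj₂ (1≤ι-suc b)

    -- Absolute values turn an approximate eigenvector of any sign pattern into a nonnegative X with
    -- r X ≤ A X + η, which stands in for a Perron vector.
    no-almost-eigenvector-approx : ∀ (x : Vector ℚ n) i r t δ e θ →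
      0ℚ ≤ t → t + (e + e) ≤ r → m ≤ (t + e) * (t + e) →
      0ℚ < δ → 0ℚ < e → e ≤ 1ℚ → 0ℚ < θ → (three + ν) * θ ≡ e * δ →
      (∀ j → ∣ A x j - r * x j ∣ < e * θ) →
      ¬ (δ ≤ ∣ x i ∣)
    no-almost-eigenvector-approx x i r t δ e θ 0≤t t+2e≤r m≤ 0<δ 0<e e≤1 0<θ θ-eq close δ≤Xi =
      SmallCodegree.no-almost-eigenvector
        (adj G) m (ι b) (adj-01 G) (adj-sym G) (handshake G) (codegree≤booksize G booksize)
        X i r η δ e (λ j → 0≤∣p∣ (x j)) rX≤ δ≤Xi 0<r (<⇒≤ (0<e ⊠ 0<θ)) 0<δ (<⇒≤ 0<e) e≤1
        m+er≤r² 9b≤r η-small (b≡0⊎1≤b b)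
      where
      η = e * θ
      X : Vector ℚ n
      X j = ∣ x j ∣

      0≤e = <⇒≤ 0<e

      e≤r : e ≤ r
      e≤r = ≤-by (0≤t ⊕ 0≤e ⊕ diff≥0 t+2e≤r)
        (solve 3 (λ t r e → r :- e := t :+ e :+ (r :- (t :+ (e :+ e)))) refl t r e)

      0<r : 0ℚ < r
      0<r = <-≤-trans 0<e e≤r

      0≤r = <⇒≤ 0<r

      -- As r - e ≥ t + e, one has r² - e r = (r - e)² + e (r - e) ≥ (t + e)² ≥ m.
      m+er≤r² : m + e * r ≤ r * r
      m+er≤r² = ≤-by
        (diff≥0 m≤ ⊕ diff≥0 t+2e≤r ⊗ (0≤t ⊕ 0≤e ⊕ diff≥0 e≤r) ⊕ 0≤e ⊗ diff≥0 e≤r)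
        (solve 4 (λ t r e m →
          r :* r :- (m :+ e :* r) :=
          ((t :+ e) :* (t :+ e) :- m) :+ (r :- (t :+ (e :+ e))) :* (t :+ e :+ (r :- e)) :+ e :* (r :- e))
          refl t r e m)

      9b≤r : (ℤ.+ 9 / 1) * ι b ≤ r
      9b≤r = <⇒≤ (square-cancel-< 0≤r (≤-<-trans
        (begin
          (ℤ.+ 9 / 1) * ι b * ((ℤ.+ 9 / 1) * ι b)
            ≡⟨ cong₂ _*_ (ι-* 9 b) (ι-* 9 b) ⟨
          ι (9 ℕ.* b) * ι (9 ℕ.* b)
            ≡⟨ ι-* (9 ℕ.* b) (9 ℕ.* b) ⟨
          ι (9 ℕ.* b ℕ.* (9 ℕ.* b))
            ≤⟨ ι-mono-≤ 81b²≤m ⟩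
          m ∎)
        (<-≤-trans
          (<-by (0<e ⊠ 0<r) (solve 2 (λ m p → m :+ p :- m := p) refl m (e * r)))
          m+er≤r²)))
        where open ≤-Reasoning

      rX≤ : ∀ j → r * X j ≤ A X j + η
      rX≤ j = begin
        r * ∣ xⱼ ∣
          ≡⟨ cong (_* ∣ xⱼ ∣) (sym (0≤p⇒∣p∣≡p 0≤r)) ⟩
        ∣ r ∣ * ∣ xⱼ ∣
          ≡⟨ ∣p*q∣≡∣p∣*∣q∣ r xⱼ ⟨
        ∣ r * xⱼ ∣
          ≡⟨ cong ∣_∣ (solve 2 (λ p q → p := q :- (q :- p)) refl (r * xⱼ) Axⱼ) ⟩
        ∣ Axⱼ - (Axⱼ - r * xⱼ) ∣
          ≤⟨ ∣p-q∣≤∣p∣+∣q∣ Axⱼ (Axⱼ - r * xⱼ) ⟩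
        ∣ Axⱼ ∣ + ∣ Axⱼ - r * xⱼ ∣
          ≤⟨ +-mono-≤ (∣A∣≤ x j)
               (<⇒≤ (close j)) ⟩
        A X j + η ∎
        where
        open ≤-Reasoning
        xⱼ = x j
        Axⱼ = A x j

      -- Since r (3 + ν) θ = r e δ, it suffices that ν e θ ≤ ν r θ and 2 r e θ ≤ 2 r θ; the third
      -- copy of r θ makes the inequality strict. The equation fixing θ does not mention r, which
      -- varies with the index of the approximation.
      η-small : (ν + (r + r)) * η < e * (r * δ)
      η-small = <-by
        ((0<θ ⊠ 0<r) ⊞ (0≤ν ⊗ <⇒≤ 0<θ ⊗ diff≥0 e≤r) ⊞ ((0≤θ ⊗ 0≤r ⊕ 0≤θ ⊗ 0≤r) ⊗ diff≥0 e≤1))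
        (sym (trans
          (solve 5 (λ θ r ν e δ →
            θ :* r :+ ν :* θ :* (r :- e) :+ (θ :* r :+ θ :* r) :* (con 1ℚ :- e) :=
            r :* ((con 1ℚ :+ con 1ℚ :+ con 1ℚ :+ ν) :* θ) :- (ν :+ (r :+ r)) :* (e :* θ))
            refl θ r ν e δ)
          (trans (cong (λ p → r * p - (ν + (r + r)) * η) θ-eq)
            (cong (_- (ν + (r + r)) * η) (solve 3 (λ r e δ → r :* (e :* δ) := e :* (r :* δ)) refl r e δ)))))
        where
        0≤θ = <⇒≤ 0<θ


    -- The k-th approximations to ρ and x satisfy the eigenvalue equation up to
    -- e * θ, where θ depends on δ; this is too close when ∣ x i ∣ ≥ δ.
    eigenvector-vanishes : ∀ {M} → (∀ i j k → seq (M i j) k ≡ adj G i j) →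
      ∀ ρ x → √ (#edges G) Defs.< ρ → (∀ i → (M · x) i Defs.≈ ρ Defs.* x i) → ∀ i → x i Defs.≈ 0ℝ
    eigenvector-vanishes {M} M≡adj ρ x (ε , 0<ε , N₀ , √m+ε<ρ) Ax≈ρx i δ 0<δ =
      let e , 0<e , e+e≤ε , e≤1 = half-or-one ε 0<ε
          θ , 0<θ , θ-eq = quotient (three + ν) (positive⁻¹ three ⊞ 0≤ν) (e * δ) (0<e ⊠ 0<δ)
          N₁ , Q-large = archimedean e 0<e
          N₂ , close = eventually-all λ j → Ax≈ρx j (e * θ) (0<e ⊠ 0<θ)
          N = N₀ ℕ.⊔ (N₁ ℕ.⊔ N₂)
      in N , λ k N≤k →
        let N₁₂≤k = ℕ.≤-trans (ℕ.m≤n⊔m N₀ (N₁ ℕ.⊔ N₂)) N≤k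
        in subst (λ t → ∣ t ∣ < δ) (sym (+-identityʳ (seq (x i) k))) (≰⇒>
          (no-almost-eigenvector-approx (λ j → seq (x j) k) i (seq ρ k) (√-approx (#edges G) k) δ e θ
            (√-approx-nonNeg (#edges G) k)
            (≤-trans (+-monoʳ-≤ (√-approx (#edges G) k) e+e≤ε)
              (<⇒≤ (√m+ε<ρ k (ℕ.≤-trans (ℕ.m≤m⊔n N₀ (N₁ ℕ.⊔ N₂)) N≤k))))
            (√-approx-upper (#edges G) k {e} (Q-large k (ℕ.≤-trans (ℕ.m≤m⊔n N₁ N₂) N₁₂≤k)))
            0<δ 0<e e≤1 0<θ θ-eq
            (λ j → subst (λ p → ∣ p - seq ρ k * seq (x j) k ∣ < e * θ) (seq-· {M = M} M≡adj x j k)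
              (close k (ℕ.≤-trans (ℕ.m≤n⊔m N₁ N₂) N₁₂≤k) j))))

  -- Put γ = 9b and δ = 1 / (2γ). Integrality gives m ≤ γ² - 1 < γ² - 1 + δ² = (γ - δ)², so every
  -- approximation to √m, from index 0 on, lies below γ - δ. Division by 9 turns δ into the gap
  -- required by the order on the reals.
  √<9b : ∀ m b → m ℕ.< 9 ℕ.* b ℕ.* (9 ℕ.* b) →
    Defs.fromℚ (ℤ.+ 1 / 9) Defs.* √ m Defs.< Defs.fromℕ b
  √<9b m b m<γ² = ninth * δ , positive⁻¹ ninth ⊠ 0<δ , 0 , λ k _ →
    subst (ninth * √-approx m k + ninth * δ <_) (ι≡/1 b) (bound k)
    where
    open ≤-Reasoning
    ninth = ℤ.+ 1 / 9
    γ = ι (9 ℕ.* b)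

    ninth-γ : ninth * γ ≡ ι b
    ninth-γ = trans (cong (λ p → ninth * p) (ι-* 9 b))
      (trans (sym (*-assoc ninth (ι 9) (ι b))) (*-identityˡ (ι b)))

    1+m≤γ² : 1ℚ + ι m ≤ γ * γ
    1+m≤γ² = subst (1ℚ + ι m ≤_) (ι-* (9 ℕ.* b) (9 ℕ.* b)) (ι-mono-≤ m<γ²)

    1≤γ : 1ℚ ≤ γ
    1≤γ = nonzero (9 ℕ.* b) m<γ²
      where
      -- A variable c is needed here, as 9 * b does not reduce to a constructor for matching.
      nonzero : ∀ c → m ℕ.< c ℕ.* c → 1ℚ ≤ ι c
      nonzero (suc c) _ = 1≤ι-suc c

    γ≤2γ : γ ≤ γ + γ
    γ≤2γ = ≤-by (≤-trans 0≤1 1≤γ) (solve 1 (λ γ → γ :+ γ :- γ := γ) refl γ)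

    0<2γ : 0ℚ < γ + γ
    0<2γ = <-≤-trans (positive⁻¹ 1ℚ) 1≤γ ⊞ ≤-trans 0≤1 1≤γ

    instance
      2γ-pos = positive 0<2γ
      2γ≢0 = pos⇒nonZero (γ + γ)

    δ = 1/ (γ + γ)

    0<δ : 0ℚ < δ
    0<δ = positive⁻¹ δ {{1/pos⇒pos (γ + γ)}}

    2γδ≡1 : (γ + γ) * δ ≡ 1ℚ
    2γδ≡1 = *-inverseʳ (γ + γ)

    δ≤γ : δ ≤ γ
    δ≤γ = begin
      δ                  ≡⟨ *-identityˡ δ ⟨
      1ℚ * δ             ≤⟨ *-monoʳ-≤-nonNeg δ {{nonNegative (<⇒≤ 0<δ)}}
                              (≤-trans 1≤γ γ≤2γ) ⟩
      (γ + γ) * δ        ≡⟨ 2γδ≡1 ⟩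
      1ℚ                 ≤⟨ 1≤γ ⟩
      γ                  ∎

    t<γ-δ : ∀ k → √-approx m k < γ - δ
    t<γ-δ k = square-cancel-< (diff≥0 δ≤γ)
      (<-by (0<δ ⊠ 0<δ ⊞ (diff≥0 (√-approx-lower m k) ⊕ diff≥0 1+m≤γ²))
        (trans
          (solve 4 (λ γ δ t m →
            (γ :- δ) :* (γ :- δ) :- t :* t :=
            δ :* δ :+ (m :- t :* t :+ (γ :* γ :- ((γ :+ γ) :* δ :+ m))))
            refl γ δ t (ι m))
          (cong (λ p → δ * δ + (ι m - t * t + (γ * γ - (p + ι m)))) 2γδ≡1)))
      where t = √-approx m k

    bound : ∀ k → ninth * √-approx m k + ninth * δ < ι b
    bound k = begin-strict
      ninth * t + ninth * δ    <⟨ <-by (positive⁻¹ ninth ⊠ diff>0 (t<γ-δ k))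
                                    (solve 4 (λ p γ δ t →
                                      p :* γ :- (p :* t :+ p :* δ) := p :* (γ :- δ :- t)) refl ninth γ δ t) ⟩
      ninth * γ                ≡⟨ ninth-γ ⟩
      ι b                      ∎
      where t = √-approx m k

open import Defs
open import Data.Empty using (⊥-elim)
open import Data.Integer using (+_)
open import Data.Product using (_,_)
open import Data.Rational using (_/_)
open import Data.Sum using ([_,_]′)
open import Relation.Nullary using (does)
open RationalEstimates using (√<9b; eigenvector-vanishes; seq-if)

corollary1p1 : ∀ {n : ℕ} (G : Graph n) → Connected G → NoIsolatedVertices G →
    ∀ (ρ : ℝ) → IsSpectralRadius G ρ → √ (#edges G) < ρ →
    ∀ (bk : ℕ) → IsBooksize G bk →
    fromℚ (+ 1 / 9) * √ (#edges G) < fromℕ bk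
corollary1p1 G _ _ ρ ((x , x≉0 , Ax≈ρx) , _) √m<ρ bk booksize =
  -- Either m < 81 bk², which yields the claim, or 81 bk² ≤ m, and then every coordinate of the
  -- eigenvector for ρ would vanish.
  [ √<9b (#edges G) bk
  , (λ 81bk²≤m → ⊥-elim (x≉0 (eigenvector-vanishes G booksize 81bk²≤m {adjacencyMatrix G}
      (λ i j k → seq-if (does (Graph.adj? G i j)) k) ρ x √m<ρ Ax≈ρx)))
  ]′ (ℕ.<-≤-connex (#edges G) (9 ℕ.* bk ℕ.* (9 ℕ.* bk)))
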